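{- For every integer $n\ge 1$, one has $e_2(n-1,n)=s_2(n)$ if and only if $n=2^{\varepsilon}(2s+1)$ for some integers $\varepsilon,s$ with $0\le\varepsilon\le 2$, $s\ge 0$ and $\binom{3s}{s}$ odd.
   Context: $\nu_2(m)$ denotes the exponent of $2$ in the integer $m$, with $\nu_2(0)=\infty$; $[x]$ is the integer part of $x$. For integers $k\ge 0$ and $j\ge 0$ define the partial Stirling number $a_2(k,j)=\sum_{i\not\equiv 0\ (\mathrm{mod}\ 2)}(-1)^i\binom{j}{i}i^k$. For $k\ge 0$, $n\ge 1$ define $e_2(k,n)=\min\{\nu_2(a_2(k,j)) : j\ge n\}$. Define $s_2(n)=n-1+\nu_2([n/2]!)$. -}

module Defs where

open import Data.Nat.Base as ℕ using (ℕ; zero; suc; _!; _^_; _/_; _∸_; NonZero; z≤n; s≤s)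
import Data.Nat.Properties as ℕ
open import Data.Nat.Divisibility using (_∣_; _∣?_; 1∣_; ∣⇒≤)
open import Data.Nat.Combinatorics using (_C_)
open import Data.Integer.Base as ℤ using (ℤ; +_; +[1+_]; -[1+_]; 0ℤ; -1ℤ)
open import Data.List.Base using (List; foldr; map; filter; upTo)
open import Data.Product.Base using (∃-syntax; _×_; _,_)
open import Level using (0ℓ)
open import Relation.Binary.Core using (Rel)
open import Relation.Binary.PropositionalEquality using (_≡_; refl)
open import Relation.Nullary.Construct.Add.Supremum using (_⁺; [_]; ⊤⁺)
import Relation.Binary.Construct.Add.Supremum.NonStrict as Supremum
open import Relation.Nullary.Decidable using (yes; no; ¬?)
open import Relation.Nullary.Negation using (¬_)
open import Relation.Unary using (Pred)

ℕ∞ : Set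
ℕ∞ = ℕ ⁺

open Supremum ℕ._≤_ public using () renaming (_≤⁺_ to _≤∞_)

-- The largest e ≤ b with 2 ^ e ∣ m.
greatestExponent : ℕ → ℕ → ℕ
greatestExponent m zero    = zero
greatestExponent m (suc b) with 2 ^ suc b ∣? m
... | yes _ = suc b
... | no  _ = greatestExponent m b

-- The bound b = m loses nothing, since 2 ^ m > m (see exponent-maximal).
exponent : (m : ℕ) .{{_ : NonZero m}} → ℕ
exponent m = greatestExponent m m

ν₂ : ℤ → ℕ∞
ν₂ (+ 0)    = ⊤⁺
ν₂ +[1+ m ] = [ exponent (suc m) ]
ν₂ -[1+ m ] = [ exponent (suc m) ]

exponent-divides : ∀ m .{{_ : NonZero m}} → 2 ^ exponent m ∣ m
exponent-divides m = go m
  where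
  go : ∀ b → 2 ^ greatestExponent m b ∣ m
  go zero = 1∣ m
  go (suc b) with 2 ^ suc b ∣? m
  ... | yes p = p
  ... | no  _ = go b

exponent-maximal : ∀ m .{{_ : NonZero m}} e → 2 ^ e ∣ m → e ℕ.≤ exponent m
exponent-maximal m e 2^e∣m =
  go m (ℕ.<⇒≤ (ℕ.<-≤-trans (n<2^n e) (∣⇒≤ 2^e∣m)))
  where
  n<2^n : ∀ n → n ℕ.< 2 ^ n
  n<2^n zero    = s≤s z≤n
  n<2^n (suc n) = ℕ.+-mono-≤ (ℕ.m^n>0 2 n) (ℕ.≤-trans (n<2^n n) (ℕ.m≤m+n (2 ^ n) 0))

  go : ∀ b → e ℕ.≤ b → e ℕ.≤ greatestExponent m b
  go zero    e≤b = e≤b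
  go (suc b) e≤b with 2 ^ suc b ∣? m
  ... | yes _ = e≤b
  ... | no ¬p = go b (ℕ.≤-pred (ℕ.≤∧≢⇒< e≤b λ { refl → ¬p 2^e∣m }))

∑[_] : List ℕ → (ℕ → ℤ) → ℤ
∑[ is ] f = foldr ℤ._+_ 0ℤ (map f is)

-- The sum runs over odd i with 0 ≤ i ≤ j only: the binomial coefficient
-- vanishes at all other integers i.
a₂ : ℕ → ℕ → ℤ
a₂ k j = ∑[ filter (λ i → ¬? (2 ∣? i)) (upTo (suc j)) ]
           (λ i → -1ℤ ℤ.^ i ℤ.* + (j C i) ℤ.* (+ i) ℤ.^ k)

IsMinimum : Pred ℕ∞ 0ℓ → Pred ℕ∞ 0ℓ
IsMinimum P v = P v × (∀ w → P w → v ≤∞ w)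

-- The relation "e₂(k,n) = v".  A minimum over infinitely many j is not
-- given by a recursion, so it enters as an attained lower bound; by
-- e₂-unique it is single-valued.
e₂⟨_,_⟩≡_ : ℕ → ℕ → ℕ∞ → Set
e₂⟨ k , n ⟩≡ v = IsMinimum (λ w → ∃[ j ] (n ℕ.≤ j × ν₂ (a₂ k j) ≡ w)) v

e₂-unique : ∀ {k n v w} → e₂⟨ k , n ⟩≡ v → e₂⟨ k , n ⟩≡ w → v ≡ w
e₂-unique (v∈ , v≤) (w∈ , w≤) =
  Supremum.≤⁺-antisym-≡ ℕ._≤_ ℕ.≤-antisym (v≤ _ w∈) (w≤ _ v∈)

s₂ : ℕ → ℕ
s₂ n = (n ∸ 1) ℕ.+ exponent ((n / 2) !) {{(n / 2) ℕ.!≢0}}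

module Submission where

-- For k < j the alternating sum Σᵢ (-1)ⁱ C(j,i) iᵏ vanishes, so a₂(k,j) = - 2ᵏ h(k,j) with
-- h(k,j) = Σᵢ C(j,2i) iᵏ.  The identity (j-i)(j-1-i) C(j,i) = j(j-1) C(j-2,i), applied to even i,
-- gives for j = 2m or j = 2m + 1 a recurrence
--   2 h(k+2,j) + m q h(k,j) = u h(k+1,j) + m q h(k,j-2)   with q and u odd.
-- It shows inductively that 2^ν(m!) divides h(k,j), and modulo 2 it turns into the recurrence
-- S(k+1,m) = m S(k,m) + S(k,m-1) for the quotients: they have the parity of the Stirling
-- numbers of the second kind.  Hence e₂(n-1,n) ≥ s₂(n), with equality iff, for M = [n/2],
-- S(n-1,M) is odd, or M is even (so that ν((M+1)!) = ν(M!)) and S(n-1,M+1) is odd.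
-- The parity of S(m+a,m) is that of C([(m-1)/2]+a, a), and Lucas' theorem for the prime 2,
-- together with C(3t+2,2t+1) = 2 C(3t+2,2t+2), reduces the criterion to C(3s,s).

open import Defs
open import Data.Integer.Base as ℤ using (-1ℤ)
import Data.Integer.Properties as ℤ
open import Data.List.Base using (filter; applyUpTo)
open import Data.List.Properties using (filter-accept; filter-reject)
open import Data.Nat.Base using (ℕ; zero; suc; _+_; _*_; _∸_; _^_; _/_; _!; _≤_; _<_; z≤n; s≤s; NonZero; parity; ⌊_/2⌋)
open import Data.Nat.Combinatorics using (_C_; nCk+nC[k+1]≡[n+1]C[k+1]; k>n⇒nCk≡0; nCk≡nC[n∸k]; nCn≡1)
open import Data.Nat.Divisibility
open import Data.Nat.DivMod using (m*n/n≡m; m<n⇒m/n≡0; +-distrib-/-∣ˡ)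
open import Data.Nat.ListAction using (sum)
open import Data.Nat.Properties
open import Data.Nat.Tactic.RingSolver using (solve-∀)
open import Data.Parity.Base as ℙ using (Parity; 0ℙ; 1ℙ)
import Data.Parity.Properties as ℙ
open import Data.Product.Base using (∃₂; ∃-syntax; _×_; _,_; proj₁; proj₂)
open import Data.Sum.Base using (_⊎_; inj₁; inj₂; [_,_]′)
open import Function.Base using (_∘_; id)
open import Function.Bundles using (_⇔_; mk⇔; module Equivalence)
import Function.Properties.Equivalence as ⇔
open import Relation.Binary.Construct.Add.Supremum.NonStrict _≤_ using ([_]; _≤⊤⁺)
open import Relation.Binary.PropositionalEquality
open import Relation.Nullary.Construct.Add.Supremum using ([_]; []-injective)
open import Relation.Nullary.Decidable using (yes; no; ¬?)
open import Relation.Nullary.Negation using (¬_; contradiction)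

-- Parity and the 2-adic valuation of factorials

even⇒2∣ : ∀ n → parity n ≡ 0ℙ → 2 ∣ n
even⇒2∣ zero          _ = 2 ∣0
even⇒2∣ (suc (suc n)) p = ∣m∣n⇒∣m+n ∣-refl (even⇒2∣ n p)

2∣⇒even : ∀ {n} → 2 ∣ n → parity n ≡ 0ℙ
2∣⇒even (divides-refl q) = trans (ℙ.*-homo-* q 2) (ℙ.*-zeroʳ (parity q))

odd⇒2∤ : ∀ {n} → parity n ≡ 1ℙ → 2 ∤ n
odd⇒2∤ p 2∣n with () ← trans (sym p) (2∣⇒even 2∣n)

2∤⇒odd : ∀ n → 2 ∤ n → parity n ≡ 1ℙ
2∤⇒odd n 2∤n with parity n in eq
... | 0ℙ = contradiction (even⇒2∣ n eq) 2∤n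
... | 1ℙ = refl

odd-factor : ∀ u x → parity u ≡ 1ℙ → parity (u * x) ≡ parity x
odd-factor u x u-odd = trans (ℙ.*-homo-* u x) (cong (ℙ._* parity x) u-odd)

-- Factors of 2 come off one at a time: modulo 2 the odd `u` acts as 1, so `x` is even, and
-- cancelling a 2 on both sides leaves the claim for `p` and half of `x`.
∣-odd-cancel : ∀ p u x → parity u ≡ 1ℙ → 2 ^ p ∣ u * x → 2 ^ p ∣ x
∣-odd-cancel zero    u x u-odd _ = 1∣ x
∣-odd-cancel (suc p) u x u-odd d
  with even⇒2∣ x (trans (sym (odd-factor u x u-odd)) (2∣⇒even (m*n∣⇒m∣ 2 (2 ^ p) d)))
... | divides-refl y = subst (2 ^ suc p ∣_) (*-comm 2 y)
        (*-monoʳ-∣ 2 (∣-odd-cancel p u y u-odd (*-cancelˡ-∣ 2 (subst (2 ^ suc p ∣_) (lemma u y) d))))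
  where
  lemma : ∀ u y → u * (y * 2) ≡ 2 * (u * y)
  lemma = solve-∀

2^-mono-∣ : ∀ {a b} → a ≤ b → 2 ^ a ∣ 2 ^ b
2^-mono-∣ {a} {b} a≤b = subst (2 ^ a ∣_) (trans (sym (^-distribˡ-+-* 2 a (b ∸ a))) (cong (2 ^_) (m+[n∸m]≡n a≤b))) (m∣m*n (2 ^ (b ∸ a)))

2^∣⇒≤ : ∀ {a b x} → parity x ≡ 1ℙ → 2 ^ a ∣ 2 ^ b * x → a ≤ b
2^∣⇒≤ {a} {b} {x} x-odd d with a ≤? b
... | yes a≤b = a≤b
... | no a≰b = contradiction 2∣x (odd⇒2∤ x-odd)
  where
  instance _ = m^n≢0 2 b
  2∣x : 2 ∣ x
  2∣x = *-cancelˡ-∣ (2 ^ b) (∣-trans (subst (_∣ 2 ^ a) (*-comm 2 (2 ^ b)) (2^-mono-∣ (≰⇒> a≰b))) d)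

exponent-unique : ∀ x .{{_ : NonZero x}} e → 2 ^ e ∣ x → ¬ 2 ^ suc e ∣ x → exponent x ≡ e
exponent-unique x e d ¬d = ≤-antisym
  (≮⇒≥ λ e<exp → ¬d (∣-trans (2^-mono-∣ e<exp) (exponent-divides x)))
  (exponent-maximal x e d)

-- The same expression as in `s₂`, so that `s₂ n` is `n ∸ 1 + v! (n / 2)` by definition.
v! : ℕ → ℕ
v! m = exponent (m !) {{m !≢0}}

odd-part! : ∀ m → ∃[ o ] (m ! ≡ 2 ^ v! m * o × parity o ≡ 1ℙ)
odd-part! m with exponent-divides (m !) {{m !≢0}}
... | divides o eq = o , trans eq (*-comm o _) , 2∤⇒odd o λ { (divides q refl) →
        <-irrefl refl (exponent-maximal (m !) {{m !≢0}} (suc (v! m))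
          (divides q (trans eq (*-assoc q 2 (2 ^ v! m))))) }

∣!⇒≤v! : ∀ {e} m → 2 ^ e ∣ m ! → e ≤ v! m
∣!⇒≤v! {e} m = exponent-maximal (m !) {{m !≢0}} e

v!-∣ : ∀ m → 2 ^ v! m ∣ m !
v!-∣ m = exponent-divides (m !) {{m !≢0}}

v!-mono : ∀ {m n} → m ≤ n → v! m ≤ v! n
v!-mono {m} {n} m≤n = ∣!⇒≤v! n (∣-trans (v!-∣ m) (m≤n⇒m!∣n! m≤n))

v!-suc-even : ∀ m → 2 ∣ suc m → v! m < v! (suc m)
v!-suc-even m d = ∣!⇒≤v! (suc m) (*-pres-∣ d (v!-∣ m))

v!-suc-odd : ∀ m → parity (suc m) ≡ 1ℙ → v! (suc m) ≡ v! m
v!-suc-odd m odd = ≤-antisym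
  (∣!⇒≤v! m (∣-odd-cancel (v! (suc m)) (suc m) (m !) odd (v!-∣ (suc m))))
  (v!-mono (n≤1+n m))

-- The double factorial (2m-1)!!, that is, the product of the odd factors of (2m)!.
∏odd : ℕ → ℕ
∏odd zero    = 1
∏odd (suc m) = (1 + 2 * m) * ∏odd m

parity-1+2*n : ∀ n → parity (1 + 2 * n) ≡ 1ℙ
parity-1+2*n n = trans (ℙ.+-homo-+ 1 (2 * n)) (cong ℙ._⁻¹ (ℙ.*-homo-* 2 n))

∏odd-odd : ∀ m → parity (∏odd m) ≡ 1ℙ
∏odd-odd zero    = refl
∏odd-odd (suc m) = trans (odd-factor (1 + 2 * m) (∏odd m) (parity-1+2*n m)) (∏odd-odd m)

[2*n]! : ∀ m → (2 * m) ! ≡ ∏odd m * (2 ^ m * m !)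
[2*n]! zero    = refl
[2*n]! (suc m) = begin
  (2 * suc m) !                                ≡⟨ cong _! (*-suc 2 m) ⟩
  (2 + 2 * m) * ((1 + 2 * m) * (2 * m) !)      ≡⟨ cong (λ z → (2 + 2 * m) * ((1 + 2 * m) * z)) ([2*n]! m) ⟩
  (2 + 2 * m) * ((1 + 2 * m) * (∏odd m * (2 ^ m * m !))) ≡⟨ lemma m (∏odd m) (2 ^ m) (m !) ⟩
  ∏odd (suc m) * (2 ^ suc m * suc m !)         ∎
  where
  open ≡-Reasoning
  lemma : ∀ m a b c → (2 + 2 * m) * ((1 + 2 * m) * (a * (b * c))) ≡ (1 + 2 * m) * a * (2 * b * ((1 + m) * c))
  lemma = solve-∀

-- One direction of Legendre's relation ν((2m)!) = m + ν(m!): in `[2*n]!` the odd factor `∏odd m`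
-- can be cancelled, which leaves 2^m m!.
v!-2*n : ∀ m → v! (2 * m) ≤ m + v! m
v!-2*n m with odd-part! m
... | o , eq , o-odd = 2^∣⇒≤ {v! (2 * m)} {m + v! m} {o} o-odd
  (subst (2 ^ v! (2 * m) ∣_) lemma (∣-odd-cancel (v! (2 * m)) (∏odd m) _ (∏odd-odd m) (subst (2 ^ v! (2 * m) ∣_) ([2*n]! m) (v!-∣ (2 * m)))))
  where
  lemma : 2 ^ m * m ! ≡ 2 ^ (m + v! m) * o
  lemma = trans (cong (2 ^ m *_) eq) (trans (sym (*-assoc (2 ^ m) _ o)) (cong (_* o) (sym (^-distribˡ-+-* 2 m (v! m)))))

data Half : ℕ → Set where
  2*_   : ∀ m → Half (2 * m)
  1+2*_ : ∀ m → Half (1 + 2 * m)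

half : ∀ n → Half n
half zero = 2* 0
half (suc n) with half n
... | 2* m = 1+2* m
... | 1+2* m = subst Half (*-suc 2 m) (2* suc m)

-- Legendre's bound, by repeated halving; `b` bounds the argument because halving is not a
-- structural descent. It provides the base case k = 0 of the divisibility of `halfPowerSum`.
v!<n : ∀ {n} → 0 < n → v! n < n
v!<n {n} = go n n ≤-refl
  where
  open ≤-Reasoning
  go : ∀ b n → n ≤ b → 0 < n → v! n < n
  go zero    n n≤0 0<n = contradiction (≤-trans 0<n n≤0) λ ()
  go (suc b) n n≤b 0<n with half n
  ... | 2* m@(suc _) = begin-strict
    v! (2 * m)  ≤⟨ v!-2*n m ⟩
    m + v! m    <⟨ +-monoʳ-< m (go b m m≤b (s≤s z≤n)) ⟩
    m + m       ≡⟨ cong (m +_) (sym (+-identityʳ m)) ⟩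
    2 * m       ∎
    where
    m≤b : m ≤ b
    m≤b = ≤-pred (<-≤-trans (m<m+n m (s≤s z≤n)) n≤b)
  ... | 1+2* zero = s≤s (≤-reflexive refl)
  ... | 1+2* m@(suc _) = begin-strict
    v! (1 + 2 * m) ≡⟨ v!-suc-odd (2 * m) (parity-1+2*n m) ⟩
    v! (2 * m)     <⟨ go b (2 * m) (≤-pred n≤b) (s≤s z≤n) ⟩
    2 * m          <⟨ n<1+n _ ⟩
    1 + 2 * m      ∎

-- Binomial sums

-- Σᵢ C(n, i) f(i): Pascal's rule turned into a recursion on n.
binomialSum : ℕ → (ℕ → ℕ) → ℕ
binomialSum zero    f = f 0
binomialSum (suc n) f = binomialSum n f + binomialSum n (f ∘ suc)

binomialSum-cong : ∀ n {f g : ℕ → ℕ} → f ≗ g → binomialSum n f ≡ binomialSum n g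
binomialSum-cong zero    f≗g = f≗g 0
binomialSum-cong (suc n) f≗g = cong₂ _+_ (binomialSum-cong n f≗g) (binomialSum-cong n (f≗g ∘ suc))

binomialSum-+ : ∀ n (f g : ℕ → ℕ) → binomialSum n (λ i → f i + g i) ≡ binomialSum n f + binomialSum n g
binomialSum-+ zero    f g = refl
binomialSum-+ (suc n) f g = trans (cong₂ _+_ (binomialSum-+ n f g) (binomialSum-+ n (f ∘ suc) (g ∘ suc)))
  (lemma (binomialSum n f) (binomialSum n g) (binomialSum n (f ∘ suc)) (binomialSum n (g ∘ suc)))
  where
  lemma : ∀ a b c d → (a + b) + (c + d) ≡ (a + c) + (b + d)
  lemma = solve-∀

binomialSum-* : ∀ n c (f : ℕ → ℕ) → binomialSum n (λ i → c * f i) ≡ c * binomialSum n f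
binomialSum-* zero    c f = refl
binomialSum-* (suc n) c f = trans (cong₂ _+_ (binomialSum-* n c f) (binomialSum-* n c (f ∘ suc)))
  (sym (*-distribˡ-+ c (binomialSum n f) (binomialSum n (f ∘ suc))))

-- i C(n+1, i) = (n+1) C(n, i-1), summed.
binomialSum-absorb : ∀ n (f : ℕ → ℕ) → binomialSum (suc n) (λ i → i * f i) ≡ suc n * binomialSum n (f ∘ suc)
binomialSum-absorb zero    f = refl
binomialSum-absorb (suc n) f = begin
  binomialSum (suc n) (λ i → i * f i) + binomialSum (suc n) (λ i → f (suc i) + i * f (suc i))
    ≡⟨ cong₂ _+_ (binomialSum-absorb n f) (binomialSum-+ (suc n) (f ∘ suc) (λ i → i * f (suc i))) ⟩
  suc n * A + (A + B + binomialSum (suc n) (λ i → i * f (suc i)))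
    ≡⟨ cong (λ z → suc n * A + (A + B + z)) (binomialSum-absorb n (f ∘ suc)) ⟩
  suc n * A + (A + B + suc n * B)
    ≡⟨ lemma n A B ⟩
  suc (suc n) * (A + B) ∎
  where
  open ≡-Reasoning
  A = binomialSum n (f ∘ suc)
  B = binomialSum n (f ∘ suc ∘ suc)
  lemma : ∀ n a b → (1 + n) * a + (a + b + (1 + n) * b) ≡ (2 + n) * (a + b)
  lemma = solve-∀

-- The complementary absorption (n+1-i) C(n+1, i) = (n+1) C(n, i), summed, with the term in i moved
-- across so that everything stays in ℕ.
binomialSum-absorb′ : ∀ n (f : ℕ → ℕ) →
  suc n * binomialSum (suc n) f ≡ binomialSum (suc n) (λ i → i * f i) + suc n * binomialSum n f
binomialSum-absorb′ n f = begin
  suc n * (binomialSum n f + binomialSum n (f ∘ suc))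
    ≡⟨ *-distribˡ-+ (suc n) (binomialSum n f) _ ⟩
  suc n * binomialSum n f + suc n * binomialSum n (f ∘ suc)
    ≡⟨ +-comm (suc n * binomialSum n f) _ ⟩
  suc n * binomialSum n (f ∘ suc) + suc n * binomialSum n f
    ≡⟨ cong (_+ suc n * binomialSum n f) (sym (binomialSum-absorb n f)) ⟩
  binomialSum (suc n) (λ i → i * f i) + suc n * binomialSum n f ∎
  where open ≡-Reasoning

-- (n+2-i)(n+1-i) C(n+2, i) = (n+2)(n+1) C(n, i), summed, with no subtraction left.
binomialSum-two-step : ∀ n (f : ℕ → ℕ) →
  binomialSum (2 + n) (λ i → i * (i * f i)) + (2 + n) * (1 + n) * binomialSum (2 + n) f
    ≡ (3 + 2 * n) * binomialSum (2 + n) (λ i → i * f i) + (2 + n) * (1 + n) * binomialSum n f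
binomialSum-two-step n f = begin
  c₂ + (2 + n) * (1 + n) * c₀
    ≡⟨ l₁ n c₂ c₀ ⟩
  c₂ + (1 + n) * ((2 + n) * c₀)
    ≡⟨ cong (λ z → c₂ + (1 + n) * z) (binomialSum-absorb′ (suc n) f) ⟩
  c₂ + (1 + n) * (c₁ + (2 + n) * b₀)
    ≡⟨ l₂ n c₁ c₂ b₀ ⟩
  c₂ + (1 + n) * c₁ + (2 + n) * ((1 + n) * b₀)
    ≡⟨ cong (λ z → c₂ + (1 + n) * c₁ + (2 + n) * z) (binomialSum-absorb′ n f) ⟩
  c₂ + (1 + n) * c₁ + (2 + n) * (b₁ + (1 + n) * a₀)
    ≡⟨ l₃ n c₁ c₂ b₁ a₀ ⟩
  (c₂ + (2 + n) * b₁) + (1 + n) * c₁ + (2 + n) * (1 + n) * a₀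
    -- Complementary absorption a third time, now for the function i f(i) and read backwards.
    ≡⟨ cong (λ z → z + (1 + n) * c₁ + (2 + n) * (1 + n) * a₀) (binomialSum-absorb′ (suc n) (λ i → i * f i)) ⟨
  (2 + n) * c₁ + (1 + n) * c₁ + (2 + n) * (1 + n) * a₀
    ≡⟨ l₄ n c₁ a₀ ⟩
  (3 + 2 * n) * c₁ + (2 + n) * (1 + n) * a₀ ∎
  where
  open ≡-Reasoning
  a₀ = binomialSum n f
  b₀ = binomialSum (1 + n) f
  b₁ = binomialSum (1 + n) (λ i → i * f i)
  c₀ = binomialSum (2 + n) f
  c₁ = binomialSum (2 + n) (λ i → i * f i)
  c₂ = binomialSum (2 + n) (λ i → i * (i * f i))
  l₁ : ∀ n c₂ c₀ → c₂ + (2 + n) * (1 + n) * c₀ ≡ c₂ + (1 + n) * ((2 + n) * c₀)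
  l₁ = solve-∀
  l₂ : ∀ n c₁ c₂ b₀ → c₂ + (1 + n) * (c₁ + (2 + n) * b₀) ≡ c₂ + (1 + n) * c₁ + (2 + n) * ((1 + n) * b₀)
  l₂ = solve-∀
  l₃ : ∀ n c₁ c₂ b₁ a₀ → c₂ + (1 + n) * c₁ + (2 + n) * (b₁ + (1 + n) * a₀) ≡ (c₂ + (2 + n) * b₁) + (1 + n) * c₁ + (2 + n) * (1 + n) * a₀
  l₃ = solve-∀
  l₄ : ∀ n c₁ a₀ → (2 + n) * c₁ + (1 + n) * c₁ + (2 + n) * (1 + n) * a₀ ≡ (3 + 2 * n) * c₁ + (2 + n) * (1 + n) * a₀
  l₄ = solve-∀

-- Sums over even and over odd indices

evenIndicator : ℕ → ℕ
evenIndicator zero          = 1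
evenIndicator (suc zero)    = 0
evenIndicator (suc (suc n)) = evenIndicator n

-- Parity enters as a weight: shifting the index by one exchanges the two indicators by computation,
-- which fits the recursion of `binomialSum`.
oddIndicator : ℕ → ℕ
oddIndicator = evenIndicator ∘ suc

even+odd : ∀ i → evenIndicator i + oddIndicator i ≡ 1
even+odd zero          = refl
even+odd (suc zero)    = refl
even+odd (suc (suc i)) = even+odd i

binomialSum-1 : ∀ n → binomialSum n (λ _ → 1) ≡ 2 ^ n
binomialSum-1 zero    = refl
binomialSum-1 (suc n) = trans (cong₂ _+_ (binomialSum-1 n) (binomialSum-1 n)) (cong (2 ^ n +_) (sym (+-identityʳ (2 ^ n))))

binomialSum-even : ∀ n → binomialSum (suc n) evenIndicator ≡ 2 ^ n
binomialSum-even n = begin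
  binomialSum n evenIndicator + binomialSum n oddIndicator   ≡⟨ binomialSum-+ n evenIndicator oddIndicator ⟨
  binomialSum n (λ i → evenIndicator i + oddIndicator i)      ≡⟨ binomialSum-cong n even+odd ⟩
  binomialSum n (λ _ → 1)                                      ≡⟨ binomialSum-1 n ⟩
  2 ^ n                                                        ∎
  where open ≡-Reasoning

binomialSum-odd : ∀ n → binomialSum (suc n) oddIndicator ≡ 2 ^ n
binomialSum-odd n = trans (+-comm (binomialSum n oddIndicator) _) (binomialSum-even n)

-- The shift c makes the induction on k close: absorption turns i into i + 1.
binomialSum-even≡odd : ∀ k {n} c → k < n →
  binomialSum n (λ i → evenIndicator i * (i + c) ^ k) ≡ binomialSum n (λ i → oddIndicator i * (i + c) ^ k)
binomialSum-even≡odd zero {suc n} c _ = begin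
  binomialSum (suc n) (λ i → evenIndicator i * 1) ≡⟨ binomialSum-cong (suc n) (λ i → *-identityʳ (evenIndicator i)) ⟩
  binomialSum (suc n) evenIndicator               ≡⟨ trans (binomialSum-even n) (sym (binomialSum-odd n)) ⟩
  binomialSum (suc n) oddIndicator                ≡⟨ binomialSum-cong (suc n) (λ i → *-identityʳ (oddIndicator i)) ⟨
  binomialSum (suc n) (λ i → oddIndicator i * 1)  ∎
  where open ≡-Reasoning
binomialSum-even≡odd (suc k) {suc n} c (s≤s k<n) = begin
  binomialSum (suc n) (λ i → evenIndicator i * (i + c) ^ suc k)
    ≡⟨ expand evenIndicator ⟩
  suc n * binomialSum n (λ i → oddIndicator i * (suc i + c) ^ k) + c * binomialSum (suc n) (λ i → evenIndicator i * (i + c) ^ k)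
    ≡⟨ cong₂ (λ x y → suc n * x + c * y) shifted (binomialSum-even≡odd k c (m<n⇒m<1+n k<n)) ⟩
  suc n * binomialSum n (λ i → evenIndicator i * (suc i + c) ^ k) + c * binomialSum (suc n) (λ i → oddIndicator i * (i + c) ^ k)
    ≡⟨ expand oddIndicator ⟨
  binomialSum (suc n) (λ i → oddIndicator i * (i + c) ^ suc k) ∎
  where
  open ≡-Reasoning
  -- One factor i + c is split off. Absorption takes care of i, lowering n and k together and
  -- exchanging the indicators; the part with c lowers only k. So k < n persists in both.
  expand : ∀ (w : ℕ → ℕ) → binomialSum (suc n) (λ i → w i * (i + c) ^ suc k)
    ≡ suc n * binomialSum n (λ i → w (suc i) * (suc i + c) ^ k) + c * binomialSum (suc n) (λ i → w i * (i + c) ^ k)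
  expand w = begin
    binomialSum (suc n) (λ i → w i * (i + c) ^ suc k)
      ≡⟨ binomialSum-cong (suc n) (λ i → lemma (w i) i c ((i + c) ^ k)) ⟩
    binomialSum (suc n) (λ i → i * (w i * (i + c) ^ k) + c * (w i * (i + c) ^ k))
      ≡⟨ binomialSum-+ (suc n) (λ i → i * (w i * (i + c) ^ k)) (λ i → c * (w i * (i + c) ^ k)) ⟩
    binomialSum (suc n) (λ i → i * (w i * (i + c) ^ k)) + binomialSum (suc n) (λ i → c * (w i * (i + c) ^ k))
      ≡⟨ cong₂ _+_ (binomialSum-absorb n (λ i → w i * (i + c) ^ k)) (binomialSum-* (suc n) c (λ i → w i * (i + c) ^ k)) ⟩
    suc n * binomialSum n (λ i → w (suc i) * (suc i + c) ^ k) + c * binomialSum (suc n) (λ i → w i * (i + c) ^ k) ∎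
    where
    lemma : ∀ w i c x → w * ((i + c) * x) ≡ i * (w * x) + c * (w * x)
    lemma = solve-∀
  shift : ∀ (w : ℕ → ℕ) → binomialSum n (λ i → w i * (i + suc c) ^ k) ≡ binomialSum n (λ i → w i * (suc i + c) ^ k)
  shift w = binomialSum-cong n (λ i → cong (λ z → w i * z ^ k) (+-suc i c))
  shifted : binomialSum n (λ i → oddIndicator i * (suc i + c) ^ k) ≡ binomialSum n (λ i → evenIndicator i * (suc i + c) ^ k)
  shifted = trans (sym (shift oddIndicator)) (trans (sym (binomialSum-even≡odd k (suc c) k<n)) (shift evenIndicator))

-- The 2-adic size of Σᵢ C(j, 2i) i ^ k

-- The sum h(k, j), taken over all indices: `⌊ i /2⌋` plays the part of the index of summation.
halfPowerSum : ℕ → ℕ → ℕ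
halfPowerSum k j = binomialSum j (λ i → evenIndicator i * ⌊ i /2⌋ ^ k)

even-half : ∀ i x → evenIndicator i * (i * x) ≡ evenIndicator i * (2 * (⌊ i /2⌋ * x))
even-half i x = begin
  evenIndicator i * (i * x)               ≡⟨ *-assoc (evenIndicator i) i x ⟨
  evenIndicator i * i * x                 ≡⟨ cong (_* x) (go i) ⟩
  evenIndicator i * (2 * ⌊ i /2⌋) * x     ≡⟨ lemma (evenIndicator i) ⌊ i /2⌋ x ⟩
  evenIndicator i * (2 * (⌊ i /2⌋ * x))   ∎
  where
  open ≡-Reasoning
  lemma : ∀ a b c → a * (2 * b) * c ≡ a * (2 * (b * c))
  lemma = solve-∀
  go : ∀ i → evenIndicator i * i ≡ evenIndicator i * (2 * ⌊ i /2⌋)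
  go zero          = refl
  go (suc zero)    = refl
  go (suc (suc i)) = begin
    evenIndicator i * (2 + i)                 ≡⟨ *-distribˡ-+ (evenIndicator i) 2 i ⟩
    evenIndicator i * 2 + evenIndicator i * i ≡⟨ cong (evenIndicator i * 2 +_) (go i) ⟩
    evenIndicator i * 2 + evenIndicator i * (2 * ⌊ i /2⌋) ≡⟨ *-distribˡ-+ (evenIndicator i) 2 _ ⟨
    evenIndicator i * (2 + 2 * ⌊ i /2⌋)       ≡⟨ cong (evenIndicator i *_) (*-suc 2 ⌊ i /2⌋) ⟨
    evenIndicator i * (2 * suc ⌊ i /2⌋)       ∎

evenPowerSum : ∀ k j → binomialSum j (λ i → evenIndicator i * i ^ k) ≡ 2 ^ k * halfPowerSum k j
evenPowerSum k j = trans (binomialSum-cong j (go k)) (binomialSum-* j (2 ^ k) _)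
  where
  open ≡-Reasoning
  go : ∀ k i → evenIndicator i * i ^ k ≡ 2 ^ k * (evenIndicator i * ⌊ i /2⌋ ^ k)
  go zero    i = sym (*-identityˡ (evenIndicator i * 1))
  go (suc k) i = begin
    evenIndicator i * (i * i ^ k)                         ≡⟨ even-half i (i ^ k) ⟩
    evenIndicator i * (2 * (⌊ i /2⌋ * i ^ k))             ≡⟨ l₁ (evenIndicator i) ⌊ i /2⌋ (i ^ k) ⟩
    2 * ⌊ i /2⌋ * (evenIndicator i * i ^ k)               ≡⟨ cong (2 * ⌊ i /2⌋ *_) (go k i) ⟩
    2 * ⌊ i /2⌋ * (2 ^ k * (evenIndicator i * ⌊ i /2⌋ ^ k)) ≡⟨ l₂ ⌊ i /2⌋ (2 ^ k) (evenIndicator i) (⌊ i /2⌋ ^ k) ⟩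
    2 ^ suc k * (evenIndicator i * ⌊ i /2⌋ ^ suc k)       ∎
    where
    l₁ : ∀ e h x → e * (2 * (h * x)) ≡ 2 * h * (e * x)
    l₁ = solve-∀
    l₂ : ∀ h p e x → 2 * h * (p * (e * x)) ≡ 2 * p * (e * (h * x))
    l₂ = solve-∀

-- The instance of `binomialSum-two-step` in which the function carries the even indicator: there
-- each factor i is twice `⌊ i /2⌋` and raises the exponent k by one.
halfPowerSum-two-step : ∀ k j →
  4 * halfPowerSum (2 + k) (2 + j) + (2 + j) * (1 + j) * halfPowerSum k (2 + j)
    ≡ (3 + 2 * j) * (2 * halfPowerSum (1 + k) (2 + j)) + (2 + j) * (1 + j) * halfPowerSum k j
halfPowerSum-two-step k j = begin
  4 * halfPowerSum (2 + k) j″ + c * halfPowerSum k j″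
    ≡⟨ cong (_+ c * halfPowerSum k j″) (trans (*-assoc 2 2 (halfPowerSum (2 + k) j″)) (sym i²≡)) ⟩
  binomialSum j″ (λ i → i * (i * f k i)) + c * halfPowerSum k j″
    ≡⟨ binomialSum-two-step j (f k) ⟩
  (3 + 2 * j) * binomialSum j″ (λ i → i * f k i) + c * halfPowerSum k j
    ≡⟨ cong (λ z → (3 + 2 * j) * z + c * halfPowerSum k j) (i≡ k) ⟩
  (3 + 2 * j) * (2 * halfPowerSum (1 + k) j″) + c * halfPowerSum k j ∎
  where
  open ≡-Reasoning
  j″ = 2 + j
  c = (2 + j) * (1 + j)
  f : ℕ → ℕ → ℕ
  f k i = evenIndicator i * ⌊ i /2⌋ ^ k
  pointwise : ∀ k i → i * f k i ≡ 2 * f (1 + k) i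
  pointwise k i = trans (l₁ i (evenIndicator i) (⌊ i /2⌋ ^ k))
    (trans (even-half i (⌊ i /2⌋ ^ k)) (l₂ (evenIndicator i) (⌊ i /2⌋ ^ suc k)))
    where
    l₁ : ∀ a b c → a * (b * c) ≡ b * (a * c)
    l₁ = solve-∀
    l₂ : ∀ a b → a * (2 * b) ≡ 2 * (a * b)
    l₂ = solve-∀
  i≡ : ∀ k → binomialSum j″ (λ i → i * f k i) ≡ 2 * halfPowerSum (1 + k) j″
  i≡ k = trans (binomialSum-cong j″ (pointwise k)) (binomialSum-* j″ 2 (f (1 + k)))
  i²≡ : binomialSum j″ (λ i → i * (i * f k i)) ≡ 2 * (2 * halfPowerSum (2 + k) j″)
  i²≡ = begin
    binomialSum j″ (λ i → i * (i * f k i))        ≡⟨ binomialSum-cong j″ (λ i → trans (cong (i *_) (pointwise k i)) (l i 2 (f (1 + k) i))) ⟩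
    binomialSum j″ (λ i → 2 * (i * f (1 + k) i))  ≡⟨ binomialSum-* j″ 2 (λ i → i * f (1 + k) i) ⟩
    2 * binomialSum j″ (λ i → i * f (1 + k) i)    ≡⟨ cong (2 *_) (i≡ (1 + k)) ⟩
    2 * (2 * halfPowerSum (2 + k) j″)              ∎
    where
    l : ∀ a b c → a * (b * c) ≡ b * (a * c)
    l = solve-∀

-- Once a common 2 is cancelled, the term with k + 2 keeps a coefficient 2 while the one with k + 1
-- has an odd coefficient. This imbalance drives the divisibility proof.
halfPowerSum-recurrence : ∀ j m q → (2 + j) * (1 + j) ≡ 2 * (suc m * q) → ∀ k →
  2 * halfPowerSum (2 + k) (2 + j) + suc m * q * halfPowerSum k (2 + j)
    ≡ (3 + 2 * j) * halfPowerSum (1 + k) (2 + j) + suc m * q * halfPowerSum k j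
halfPowerSum-recurrence j m q eq k = *-cancelˡ-≡ _ _ 2 (begin
  2 * (2 * h₂ + suc m * q * h₀)                        ≡⟨ l₁ h₂ (suc m * q) h₀ ⟩
  4 * h₂ + 2 * (suc m * q) * h₀                        ≡⟨ cong (λ z → 4 * h₂ + z * h₀) eq ⟨
  4 * h₂ + (2 + j) * (1 + j) * h₀                      ≡⟨ halfPowerSum-two-step k j ⟩
  (3 + 2 * j) * (2 * h₁) + (2 + j) * (1 + j) * h       ≡⟨ cong (λ z → (3 + 2 * j) * (2 * h₁) + z * h) eq ⟩
  (3 + 2 * j) * (2 * h₁) + 2 * (suc m * q) * h         ≡⟨ l₂ j h₁ (suc m * q) h ⟩
  2 * ((3 + 2 * j) * h₁ + suc m * q * h)               ∎)
  where
  open ≡-Reasoning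
  h  = halfPowerSum k j
  h₀ = halfPowerSum k (2 + j)
  h₁ = halfPowerSum (1 + k) (2 + j)
  h₂ = halfPowerSum (2 + k) (2 + j)
  l₁ : ∀ x c y → 2 * (2 * x + c * y) ≡ 4 * x + 2 * c * y
  l₁ = solve-∀
  l₂ : ∀ j x c y → (3 + 2 * j) * (2 * x) + 2 * c * y ≡ 2 * ((3 + 2 * j) * x + c * y)
  l₂ = solve-∀

-- Comparison with Stirling numbers of the second kind modulo 2

halfPowerSum-zero : ∀ j → halfPowerSum 0 (suc j) ≡ 2 ^ j
halfPowerSum-zero j = trans (binomialSum-cong (suc j) (λ i → *-identityʳ (evenIndicator i))) (binomialSum-even j)

stirlingParity : ℕ → ℕ → Parity
stirlingParity zero    zero    = 1ℙ
stirlingParity zero    (suc m) = 0ℙ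
stirlingParity (suc k) zero    = 0ℙ
stirlingParity (suc k) (suc m) = parity (suc m) ℙ.* stirlingParity k (suc m) ℙ.+ stirlingParity k m

-- Only the index 0 contributes, and `0 ^ 0` is 1 in agreement with S(0, 0) = 1.
halfPowerSum-base : ∀ δ → δ ≤ 1 → ∀ k → halfPowerSum k δ ≡ 0 ^ k
halfPowerSum-base zero       _ k = +-identityʳ (0 ^ k)
halfPowerSum-base (suc zero) _ k = trans (+-identityʳ _) (+-identityʳ (0 ^ k))
halfPowerSum-base (suc (suc _)) (s≤s ())

parity-0^ : ∀ k → parity (0 ^ k) ≡ stirlingParity k 0
parity-0^ zero    = refl
parity-0^ (suc k) = refl

-- Of two consecutive integers the even one is 2(m+1), and q is the odd one: 2m + 1 for δ = 0, 2m +
-- 3 for δ = 1.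
oddCofactor : ∀ δ → δ ≤ 1 → ∀ m → ∃[ q ] ((2 + (m * 2 + δ)) * (1 + (m * 2 + δ)) ≡ 2 * (suc m * q) × parity q ≡ 1ℙ)
oddCofactor zero       _ m = 1 + 2 * m , lemma m , parity-1+2*n m
  where
  lemma : ∀ m → (2 + (m * 2 + 0)) * (1 + (m * 2 + 0)) ≡ 2 * ((1 + m) * (1 + 2 * m))
  lemma = solve-∀
oddCofactor (suc zero) _ m = 1 + 2 * suc m , lemma m , parity-1+2*n (suc m)
  where
  lemma : ∀ m → (2 + (m * 2 + 1)) * (1 + (m * 2 + 1)) ≡ 2 * ((1 + m) * (1 + 2 * (1 + m)))
  lemma = solve-∀
oddCofactor (suc (suc _)) (s≤s ())

-- The cofactor c is the quotient of the odd parts of (m+1)! and m!, hence odd. It rescales the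
-- contribution of m to the power of 2 that belongs to m + 1.
suc*2^v! : ∀ m → ∃[ c ] (suc m * 2 ^ v! m ≡ 2 ^ v! (suc m) * c × parity c ≡ 1ℙ)
suc*2^v! m with odd-part! m | odd-part! (suc m)
... | o , eq , o-odd | o′ , eq′ , o′-odd = c , c-eq , trans (sym (odd-factor o c o-odd)) (trans (cong parity o*c≡o′) o′-odd)
  where
  instance _ = m^n≢0 2 (v! (suc m))
  l : ∀ a b c → a * (b * c) ≡ c * (a * b)
  l = solve-∀
  !-eq : o * (suc m * 2 ^ v! m) ≡ 2 ^ v! (suc m) * o′
  !-eq = trans (sym (l (suc m) (2 ^ v! m) o)) (trans (cong (suc m *_) (sym eq)) eq′)
  d : 2 ^ v! (suc m) ∣ suc m * 2 ^ v! m
  d = ∣-odd-cancel (v! (suc m)) o _ o-odd (subst (2 ^ v! (suc m) ∣_) (sym !-eq) (m∣m*n o′))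
  c = quotient d
  c-eq : suc m * 2 ^ v! m ≡ 2 ^ v! (suc m) * c
  c-eq = m∣n⇒n≡m*quotient d
  o*c≡o′ : o * c ≡ o′
  o*c≡o′ = *-cancelˡ-≡ (o * c) o′ (2 ^ v! (suc m))
    (trans (l′ (2 ^ v! (suc m)) o c) (trans (cong (o *_) (sym c-eq)) !-eq))
    where
    l′ : ∀ a b c → a * (b * c) ≡ b * (a * c)
    l′ = solve-∀

-- Modulo 2 the term `2 * g″` disappears, the odd coefficients become 1 and signs do not matter. For
-- a = m + 1 the Stirling recurrence remains.
parity-recurrence : ∀ a q u c {g g′ g″ h} → parity q ≡ 1ℙ → parity u ≡ 1ℙ → parity c ≡ 1ℙ →
  2 * g″ + a * q * g ≡ u * g′ + q * c * h → parity g′ ≡ parity a ℙ.* parity g ℙ.+ parity h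
parity-recurrence a q u c {g} {g′} {g″} {h} q-odd u-odd c-odd eq =
  solve-for-second (parity a ℙ.* parity g) (parity g′) (parity h) (begin
    parity a ℙ.* parity g            ≡⟨ cong (ℙ._* parity g) (trans (cong (parity a ℙ.*_) q-odd) (ℙ.*-identityʳ _)) ⟨
    (parity a ℙ.* parity q) ℙ.* parity g ≡⟨ cong (ℙ._* parity g) (ℙ.*-homo-* a q) ⟨
    parity (a * q) ℙ.* parity g      ≡⟨ ℙ.*-homo-* (a * q) g ⟨
    parity (a * q * g)               ≡⟨ cong (ℙ._+ parity (a * q * g)) (ℙ.*-homo-* 2 g″) ⟨
    parity (2 * g″) ℙ.+ parity (a * q * g) ≡⟨ ℙ.+-homo-+ (2 * g″) (a * q * g) ⟨
    parity (2 * g″ + a * q * g)      ≡⟨ cong parity eq ⟩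
    parity (u * g′ + q * c * h)      ≡⟨ ℙ.+-homo-+ (u * g′) (q * c * h) ⟩
    parity (u * g′) ℙ.+ parity (q * c * h)
      ≡⟨ cong₂ ℙ._+_ (odd-factor u g′ u-odd) (odd-factor (q * c) h (trans (odd-factor q c q-odd) c-odd)) ⟩
    parity g′ ℙ.+ parity h           ∎)
  where
  open ≡-Reasoning
  solve-for-second : ∀ x y z → x ≡ y ℙ.+ z → y ≡ x ℙ.+ z
  solve-for-second x y z refl = sym (trans (ℙ.+-assoc y z z) (trans (cong (y ℙ.+_) (ℙ.p+p≡0ℙ z)) (ℙ.+-identityʳ y)))

module _ (δ : ℕ) (δ≤1 : δ ≤ 1) where

  -- Stated for all k at once, since the recurrence mixes neighbouring k; the last bit δ is fixed
  -- because j moves in steps of two. With `m * 2` on the left, `suc m * 2 + δ` computes to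
  -- `2 + (m * 2 + δ)`.
  HalfPowerSum-2-adic : ℕ → Set
  HalfPowerSum-2-adic m = ∀ k →
    ∃[ g ] (halfPowerSum k (m * 2 + δ) ≡ 2 ^ v! m * g × parity g ≡ stirlingParity k m)

  module Step (m : ℕ) (ih : HalfPowerSum-2-adic m) where
    open ≡-Reasoning
    j = m * 2 + δ
    v = v! (suc m)
    q = proj₁ (oddCofactor δ δ≤1 m)
    q-odd = proj₂ (proj₂ (oddCofactor δ δ≤1 m))
    u = 3 + 2 * j
    u-odd : parity u ≡ 1ℙ
    u-odd = parity-1+2*n j
    c = proj₁ (suc*2^v! m)
    c-odd = proj₂ (proj₂ (suc*2^v! m))
    g₀ : ℕ → ℕ
    g₀ k = proj₁ (ih k)

    instance
      2^v≢0 : NonZero (2 ^ v)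
      2^v≢0 = m^n≢0 2 v

    recurrence : ∀ k →
      2 * halfPowerSum (2 + k) (2 + j) + suc m * q * halfPowerSum k (2 + j)
        ≡ u * halfPowerSum (1 + k) (2 + j) + suc m * q * halfPowerSum k j
    recurrence = halfPowerSum-recurrence j m q (proj₁ (proj₂ (oddCofactor δ δ≤1 m)))

    previous : ∀ k → suc m * q * halfPowerSum k j ≡ 2 ^ v * (q * c * g₀ k)
    previous k = begin
      suc m * q * halfPowerSum k j        ≡⟨ cong (suc m * q *_) (proj₁ (proj₂ (ih k))) ⟩
      suc m * q * (2 ^ v! m * g₀ k)        ≡⟨ l₁ (suc m) q (2 ^ v! m) (g₀ k) ⟩
      suc m * 2 ^ v! m * (q * g₀ k)        ≡⟨ cong (_* (q * g₀ k)) (proj₁ (proj₂ (suc*2^v! m))) ⟩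
      2 ^ v * c * (q * g₀ k)               ≡⟨ l₂ (2 ^ v) c q (g₀ k) ⟩
      2 ^ v * (q * c * g₀ k)               ∎
      where
      l₁ : ∀ a q p g → a * q * (p * g) ≡ a * p * (q * g)
      l₁ = solve-∀
      l₂ : ∀ p c q g → p * c * (q * g) ≡ p * (q * c * g)
      l₂ = solve-∀

    -- h(0, j+2) is the pure power 2^(j+1), and v ≤ m ≤ j. The factor beyond 2^v is what makes the
    -- quotient even, matching S(0, m+1) = 0.
    2^[1+v]∣zeroth : 2 ^ suc v ∣ halfPowerSum 0 (2 + j)
    2^[1+v]∣zeroth = subst (2 ^ suc v ∣_) (sym (halfPowerSum-zero (1 + j)))
      (2^-mono-∣ (≤-trans (v!<n (s≤s z≤n)) (s≤s (≤-trans (m≤m*n m 2) (m≤m+n (m * 2) δ)))))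

    -- The recurrence for k + 1 also involves k + 2, so induction on k alone does not close. The
    -- outer induction on p does it: divisibility by 2^p, known for every k, suffices for the term
    -- with k + 2, whose coefficient 2 supplies the missing factor.
    divisible : ∀ p → p ≤ v → ∀ k → 2 ^ p ∣ halfPowerSum k (2 + j)
    divisible zero    _   k = 1∣ _
    divisible (suc p) p<v zero = ∣-trans (2^-mono-∣ (m≤n⇒m≤1+n p<v)) 2^[1+v]∣zeroth
    divisible (suc p) p<v (suc k) = ∣-odd-cancel (suc p) u _ u-odd
      (∣m+n∣m⇒∣n
        (subst (2 ^ suc p ∣_) (trans (recurrence k) (+-comm (u * halfPowerSum (1 + k) (2 + j)) _))
          (∣m∣n⇒∣m+n (*-monoʳ-∣ 2 (divisible p (<⇒≤ p<v) (2 + k)))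
                     (∣n⇒∣m*n (suc m * q) (divisible (suc p) p<v k))))
        (subst (2 ^ suc p ∣_) (sym (previous k)) (∣m⇒∣m*n _ (2^-mono-∣ p<v))))

    g : ℕ → ℕ
    g k = quotient (divisible v ≤-refl k)

    g-eq : ∀ k → halfPowerSum k (2 + j) ≡ 2 ^ v * g k
    g-eq k = m∣n⇒n≡m*quotient (divisible v ≤-refl k)

    g-recurrence : ∀ k → 2 * g (2 + k) + suc m * q * g k ≡ u * g (1 + k) + q * c * g₀ k
    g-recurrence k = *-cancelˡ-≡ _ _ (2 ^ v) (begin
      2 ^ v * (2 * g (2 + k) + suc m * q * g k)          ≡⟨ l₁ (2 ^ v) (g (2 + k)) (suc m * q) (g k) ⟩
      2 * (2 ^ v * g (2 + k)) + suc m * q * (2 ^ v * g k) ≡⟨ cong₂ (λ x y → 2 * x + suc m * q * y) (g-eq (2 + k)) (g-eq k) ⟨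
      2 * halfPowerSum (2 + k) (2 + j) + suc m * q * halfPowerSum k (2 + j) ≡⟨ recurrence k ⟩
      u * halfPowerSum (1 + k) (2 + j) + suc m * q * halfPowerSum k j ≡⟨ cong₂ (λ x y → u * x + y) (g-eq (1 + k)) (previous k) ⟩
      u * (2 ^ v * g (1 + k)) + 2 ^ v * (q * c * g₀ k)   ≡⟨ l₂ (2 ^ v) u (g (1 + k)) (q * c * g₀ k) ⟩
      2 ^ v * (u * g (1 + k) + q * c * g₀ k)             ∎)
      where
      l₁ : ∀ p x a y → p * (2 * x + a * y) ≡ 2 * (p * x) + a * (p * y)
      l₁ = solve-∀
      l₂ : ∀ p u x y → u * (p * x) + p * y ≡ p * (u * x + y)
      l₂ = solve-∀

    g-parity : ∀ k → parity (g k) ≡ stirlingParity k (suc m)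
    g-parity zero    = 2∣⇒even (*-cancelˡ-∣ (2 ^ v) (subst₂ _∣_ (*-comm 2 (2 ^ v)) (g-eq 0) 2^[1+v]∣zeroth))
    g-parity (suc k) = trans (parity-recurrence (suc m) q u c {g k} {g (1 + k)} {g (2 + k)} {g₀ k} q-odd u-odd c-odd (g-recurrence k))
      (cong₂ (λ x y → parity (suc m) ℙ.* x ℙ.+ y) (g-parity k) (proj₂ (proj₂ (ih k))))

    result : HalfPowerSum-2-adic (suc m)
    result k = g k , g-eq k , g-parity k

  halfPowerSum-2-adic : ∀ m → HalfPowerSum-2-adic m
  halfPowerSum-2-adic zero    k = 0 ^ k , trans (halfPowerSum-base δ δ≤1 k) (sym (+-identityʳ (0 ^ k))) , parity-0^ k
  halfPowerSum-2-adic (suc m) = Step.result m (halfPowerSum-2-adic m)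

-- Partial Stirling numbers

sum-cong : ∀ N {f g : ℕ → ℕ} → f ≗ g → sum (applyUpTo f N) ≡ sum (applyUpTo g N)
sum-cong zero    f≗g = refl
sum-cong (suc N) f≗g = cong₂ _+_ (f≗g 0) (sum-cong N (f≗g ∘ suc))

sum-+ : ∀ N (f g : ℕ → ℕ) → sum (applyUpTo (λ i → f i + g i) N) ≡ sum (applyUpTo f N) + sum (applyUpTo g N)
sum-+ zero    f g = refl
sum-+ (suc N) f g = trans (cong (f 0 + g 0 +_) (sum-+ N (f ∘ suc) (g ∘ suc)))
  (lemma (f 0) (g 0) (sum (applyUpTo (f ∘ suc) N)) (sum (applyUpTo (g ∘ suc) N)))
  where
  lemma : ∀ a b c d → a + b + (c + d) ≡ a + c + (b + d)
  lemma = solve-∀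

sum-0 : ∀ N → sum (applyUpTo (λ _ → 0) N) ≡ 0
sum-0 zero    = refl
sum-0 (suc N) = sum-0 N

-- Terms beyond n vanish, so `N` is free above n. The induction uses this freedom: of the two halves
-- of Pascal's rule, one keeps the length of the list and the other shortens it.
sum-C : ∀ n N (f : ℕ → ℕ) → n < N → sum (applyUpTo (λ i → (n C i) * f i) N) ≡ binomialSum n f
sum-C zero (suc N) f _ = begin
  f 0 + 0 + sum (applyUpTo (λ i → (0 C suc i) * f (suc i)) N) ≡⟨ cong₂ _+_ (+-identityʳ (f 0)) (sum-cong N (λ i → cong (_* f (suc i)) (k>n⇒nCk≡0 {0} {suc i} (s≤s z≤n)))) ⟩
  f 0 + sum (applyUpTo (λ _ → 0) N) ≡⟨ cong (f 0 +_) (sum-0 N) ⟩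
  f 0 + 0                           ≡⟨ +-identityʳ (f 0) ⟩
  f 0                               ∎
  where open ≡-Reasoning
sum-C (suc n) (suc N) f (s≤s n<N) = begin
  (suc n C 0) * f 0 + sum (applyUpTo (λ i → (suc n C suc i) * f (suc i)) N)
    ≡⟨ cong (1 * f 0 +_) (trans (sum-cong N pascal) (sum-+ N _ _)) ⟩
  1 * f 0 + (sum (applyUpTo (λ i → (n C i) * f (suc i)) N) + sum (applyUpTo (λ i → (n C suc i) * f (suc i)) N))
    ≡⟨ lemma (1 * f 0) (sum (applyUpTo (λ i → (n C i) * f (suc i)) N)) _ ⟩
  sum (applyUpTo (λ i → (n C i) * f i) (suc N)) + sum (applyUpTo (λ i → (n C i) * f (suc i)) N)
    ≡⟨ cong₂ _+_ (sum-C n (suc N) f (m<n⇒m<1+n n<N)) (sum-C n N (f ∘ suc) n<N) ⟩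
  binomialSum n f + binomialSum n (f ∘ suc) ∎
  where
  open ≡-Reasoning
  lemma : ∀ a b c → a + (b + c) ≡ a + c + b
  lemma = solve-∀
  pascal : ∀ i → (suc n C suc i) * f (suc i) ≡ (n C i) * f (suc i) + (n C suc i) * f (suc i)
  pascal i = trans (cong (_* f (suc i)) (sym (nCk+nC[k+1]≡[n+1]C[k+1] n i))) (*-distribʳ-+ (f (suc i)) (n C i) (n C suc i))

pos-^ : ∀ i k → (ℤ.+ i) ℤ.^ k ≡ ℤ.+ (i ^ k)
pos-^ i zero    = refl
pos-^ i (suc k) = trans (cong (ℤ.+ i ℤ.*_) (pos-^ i k)) (sym (ℤ.pos-* i (i ^ k)))

-1^odd : ∀ i → parity i ≡ 1ℙ → -1ℤ ℤ.^ i ≡ -1ℤ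
-1^odd (suc zero)    _ = refl
-1^odd (suc (suc i)) p = begin
  -1ℤ ℤ.* (-1ℤ ℤ.* -1ℤ ℤ.^ i) ≡⟨ cong (λ z → -1ℤ ℤ.* (-1ℤ ℤ.* z)) (-1^odd i p) ⟩
  -1ℤ                         ∎
  where open ≡-Reasoning

oddIndicator-odd : ∀ i → parity i ≡ 1ℙ → oddIndicator i ≡ 1
oddIndicator-odd (suc zero)    _ = refl
oddIndicator-odd (suc (suc i)) p = oddIndicator-odd i p

oddIndicator-even : ∀ i → parity i ≡ 0ℙ → oddIndicator i ≡ 0
oddIndicator-even zero          _ = refl
oddIndicator-even (suc (suc i)) p = oddIndicator-even i p

a₂-term : ∀ k j i → parity i ≡ 1ℙ → -1ℤ ℤ.^ i ℤ.* ℤ.+ (j C i) ℤ.* (ℤ.+ i) ℤ.^ k ≡ ℤ.- (ℤ.+ ((j C i) * (oddIndicator i * i ^ k)))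
a₂-term k j i i-odd = begin
  -1ℤ ℤ.^ i ℤ.* ℤ.+ (j C i) ℤ.* (ℤ.+ i) ℤ.^ k ≡⟨ cong₂ (λ x y → x ℤ.* ℤ.+ (j C i) ℤ.* y) (-1^odd i i-odd) (pos-^ i k) ⟩
  -1ℤ ℤ.* ℤ.+ (j C i) ℤ.* ℤ.+ (i ^ k)         ≡⟨ ℤ.*-assoc -1ℤ (ℤ.+ (j C i)) (ℤ.+ (i ^ k)) ⟩
  -1ℤ ℤ.* (ℤ.+ (j C i) ℤ.* ℤ.+ (i ^ k))       ≡⟨ ℤ.-1*i≡-i _ ⟩
  ℤ.- (ℤ.+ (j C i) ℤ.* ℤ.+ (i ^ k))           ≡⟨ cong ℤ.-_ (ℤ.pos-* (j C i) (i ^ k)) ⟨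
  ℤ.- (ℤ.+ ((j C i) * i ^ k))               ≡⟨ cong (λ z → ℤ.- (ℤ.+ ((j C i) * z))) (trans (cong (_* i ^ k) (oddIndicator-odd i i-odd)) (*-identityˡ (i ^ k))) ⟨
  ℤ.- (ℤ.+ ((j C i) * (oddIndicator i * i ^ k))) ∎
  where open ≡-Reasoning

-- The filter becomes the weight `oddIndicator`. The function `g` generalises the identity in
-- `upTo`, since passing to the tail replaces it by `g ∘ suc`.
a₂≡-sum : ∀ k j N (g : ℕ → ℕ) →
  ∑[ filter (λ i → ¬? (2 ∣? i)) (applyUpTo g N) ] (λ i → -1ℤ ℤ.^ i ℤ.* ℤ.+ (j C i) ℤ.* (ℤ.+ i) ℤ.^ k)
    ≡ ℤ.- (ℤ.+ sum (applyUpTo (λ i → (j C g i) * (oddIndicator (g i) * g i ^ k)) N))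
a₂≡-sum k j zero    g = refl
a₂≡-sum k j (suc N) g with parity (g 0) in eq
... | 0ℙ = begin
  ∑[ filter odd? (applyUpTo g (suc N)) ] F      ≡⟨ cong (λ is → ∑[ is ] F) (filter-reject odd? {g 0} {applyUpTo (g ∘ suc) N} (λ 2∤g0 → 2∤g0 (even⇒2∣ (g 0) eq))) ⟩
  ∑[ filter odd? (applyUpTo (g ∘ suc) N) ] F    ≡⟨ a₂≡-sum k j N (g ∘ suc) ⟩
  ℤ.- (ℤ.+ sum (applyUpTo (G ∘ suc) N))           ≡⟨ cong (λ z → ℤ.- (ℤ.+ (z + sum (applyUpTo (G ∘ suc) N)))) G0≡0 ⟨
  ℤ.- (ℤ.+ sum (applyUpTo G (suc N)))             ∎
  where
  open ≡-Reasoning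
  odd? = λ i → ¬? (2 ∣? i)
  F = λ i → -1ℤ ℤ.^ i ℤ.* ℤ.+ (j C i) ℤ.* (ℤ.+ i) ℤ.^ k
  G = λ i → (j C g i) * (oddIndicator (g i) * g i ^ k)
  G0≡0 : G 0 ≡ 0
  G0≡0 = trans (cong (λ z → (j C g 0) * (z * g 0 ^ k)) (oddIndicator-even (g 0) eq)) (*-zeroʳ (j C g 0))
... | 1ℙ = begin
  ∑[ filter odd? (applyUpTo g (suc N)) ] F         ≡⟨ cong (λ is → ∑[ is ] F) (filter-accept odd? {g 0} {applyUpTo (g ∘ suc) N} (odd⇒2∤ eq)) ⟩
  F (g 0) ℤ.+ ∑[ filter odd? (applyUpTo (g ∘ suc) N) ] F ≡⟨ cong₂ ℤ._+_ (a₂-term k j (g 0) eq) (a₂≡-sum k j N (g ∘ suc)) ⟩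
  ℤ.- (ℤ.+ G 0) ℤ.+ ℤ.- (ℤ.+ sum (applyUpTo (G ∘ suc) N)) ≡⟨ ℤ.neg-distrib-+ (ℤ.+ G 0) _ ⟨
  ℤ.- (ℤ.+ sum (applyUpTo G (suc N)))                ∎
  where
  open ≡-Reasoning
  odd? = λ i → ¬? (2 ∣? i)
  F = λ i → -1ℤ ℤ.^ i ℤ.* ℤ.+ (j C i) ℤ.* (ℤ.+ i) ℤ.^ k
  G = λ i → (j C g i) * (oddIndicator (g i) * g i ^ k)

-- For k < j the odd-index sum may be exchanged for the even-index one, and there every i ^ k is
-- visibly a multiple of 2^k.
a₂≡-2^k*halfPowerSum : ∀ {k j} → k < j → a₂ k j ≡ ℤ.- (ℤ.+ (2 ^ k * halfPowerSum k j))
a₂≡-2^k*halfPowerSum {k} {j} k<j = trans (a₂≡-sum k j (suc j) (λ i → i)) (cong (λ z → ℤ.- (ℤ.+ z)) (begin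
  sum (applyUpTo (λ i → (j C i) * (oddIndicator i * i ^ k)) (suc j)) ≡⟨ sum-C j (suc j) _ ≤-refl ⟩
  binomialSum j (λ i → oddIndicator i * i ^ k)         ≡⟨ unshift oddIndicator ⟨
  binomialSum j (λ i → oddIndicator i * (i + 0) ^ k)   ≡⟨ binomialSum-even≡odd k 0 k<j ⟨
  binomialSum j (λ i → evenIndicator i * (i + 0) ^ k)  ≡⟨ unshift evenIndicator ⟩
  binomialSum j (λ i → evenIndicator i * i ^ k)        ≡⟨ evenPowerSum k j ⟩
  2 ^ k * halfPowerSum k j                             ∎))
  where
  open ≡-Reasoning
  unshift : ∀ (w : ℕ → ℕ) → binomialSum j (λ i → w i * (i + 0) ^ k) ≡ binomialSum j (λ i → w i * i ^ k)
  unshift w = binomialSum-cong j (λ i → cong (λ z → w i * z ^ k) (+-identityʳ i))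

-- From divisibility to `ν₂` and its minimum

2^∣⇒≤ν₂ : ∀ {s} x → 2 ^ s ∣ x → [ s ] ≤∞ ν₂ (ℤ.- (ℤ.+ x))
2^∣⇒≤ν₂ {s} zero    d = [ s ] ≤⊤⁺
2^∣⇒≤ν₂ {s} (suc x) d = [ exponent-maximal (suc x) s d ]

ν₂-exact : ∀ {s} x → 2 ^ s ∣ x → 2 ^ suc s ∤ x → ν₂ (ℤ.- (ℤ.+ x)) ≡ [ s ]
ν₂-exact {s} zero    _ ¬d = contradiction ((2 ^ suc s) ∣0) ¬d
ν₂-exact {s} (suc x) d ¬d = cong [_] (exponent-unique (suc x) s d ¬d)

ν₂≡⇒∤ : ∀ {s} x → ν₂ (ℤ.- (ℤ.+ x)) ≡ [ s ] → 2 ^ suc s ∤ x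
ν₂≡⇒∤ zero    ()
ν₂≡⇒∤ {s} (suc x) eq d = 1+n≰n (subst (suc s ≤_) ([]-injective eq) (exponent-maximal (suc x) (suc s) d))

-- `v!` jumps at every even argument, so a stretch on which it is constant consists of an even
-- number and its successor.
v!-constant : ∀ {m M} → M ≤ m → v! m ≤ v! M → m ≡ M ⊎ (m ≡ suc M × parity M ≡ 0ℙ)
v!-constant {m} {M} M≤m v≤ with M ≟ m
... | yes M≡m = inj₁ (sym M≡m)
... | no M≢m = inj₂ (m≡1+M , parityM M-odd)
  where
  M<m : M < m
  M<m = ≤∧≢⇒< M≤m M≢m
  M-odd : 2 ∤ suc M
  M-odd 2∣1+M = <-irrefl refl (<-≤-trans (v!-suc-even M 2∣1+M) (≤-trans (v!-mono M<m) v≤))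
  parityM : ∀ {M} → 2 ∤ suc M → parity M ≡ 0ℙ
  parityM {M} 2∤1+M = trans (sym (ℙ.suc-homo-⁻¹ M)) (cong ℙ._⁻¹ (2∤⇒odd (suc M) 2∤1+M))
  2∣2+M : 2 ∣ suc (suc M)
  2∣2+M = even⇒2∣ (suc (suc M)) (parityM M-odd)
  m≡1+M : m ≡ suc M
  m≡1+M = ≤-antisym (≮⇒≥ λ 2+M≤m → <-irrefl refl (begin-strict
      v! M             ≤⟨ v!-mono (n≤1+n M) ⟩
      v! (suc M)       <⟨ v!-suc-even (suc M) 2∣2+M ⟩
      v! (suc (suc M)) ≤⟨ v!-mono 2+M≤m ⟩
      v! m             ≤⟨ v≤ ⟩
      v! M             ∎)) M<m
    where open ≤-Reasoning

half-with-bit : ∀ n → ∃[ m ] ∃[ δ ] (δ ≤ 1 × n ≡ m * 2 + δ)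
half-with-bit zero          = 0 , 0 , z≤n , refl
half-with-bit (suc zero)    = 0 , 1 , s≤s z≤n , refl
half-with-bit (suc (suc n)) with half-with-bit n
... | m , δ , δ≤1 , refl = suc m , δ , δ≤1 , refl

[m*2+δ]/2≡m : ∀ m δ → δ ≤ 1 → (m * 2 + δ) / 2 ≡ m
[m*2+δ]/2≡m m δ δ≤1 = trans (+-distrib-/-∣ˡ δ (n∣m*n m))
  (trans (cong₂ _+_ (m*n/n≡m m 2) (m<n⇒m/n≡0 (s≤s δ≤1))) (+-identityʳ m))

m*2+δ-cancel-≤ : ∀ {m m′ δ δ′} → δ′ ≤ 1 → m * 2 + δ ≤ m′ * 2 + δ′ → m ≤ m′
m*2+δ-cancel-≤ {m} {m′} {δ} {δ′} δ′≤1 le = ≮⇒≥ λ m′<m → <-irrefl refl (begin-strict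
  m′ * 2 + δ′ ≤⟨ +-monoʳ-≤ (m′ * 2) δ′≤1 ⟩
  m′ * 2 + 1  <⟨ +-monoʳ-< (m′ * 2) (s≤s (s≤s z≤n)) ⟩
  m′ * 2 + 2  ≡⟨ +-comm (m′ * 2) 2 ⟩
  suc m′ * 2  ≤⟨ *-monoˡ-≤ 2 m′<m ⟩
  m * 2       ≤⟨ m≤m+n (m * 2) δ ⟩
  m * 2 + δ   ≤⟨ le ⟩
  m′ * 2 + δ′ ∎)
  where open ≤-Reasoning

s₂≡ : ∀ {k} M δ → δ ≤ 1 → suc k ≡ M * 2 + δ → s₂ (suc k) ≡ k + v! M
s₂≡ {k} M δ δ≤1 eq = cong (λ z → k + v! z) (trans (cong (_/ 2) eq) ([m*2+δ]/2≡m M δ δ≤1))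

-- One alternative for each m ≥ M with ν(m!) = ν(M!); only for such m can j = 2m or j = 2m + 1 reach
-- the bound.
StirlingCriterion : ℕ → ℕ → Set
StirlingCriterion k M = stirlingParity k M ≡ 1ℙ ⊎ (parity M ≡ 0ℙ × stirlingParity k (suc M) ≡ 1ℙ)

module _ {k M δ} (δ≤1 : δ ≤ 1) (n≡ : suc k ≡ M * 2 + δ) where

  private
    s = k + v! M

  a₂-2-adic : ∀ m δ′ → δ′ ≤ 1 → suc k ≤ m * 2 + δ′ →
    ∃[ g ] (a₂ k (m * 2 + δ′) ≡ ℤ.- (ℤ.+ (2 ^ (k + v! m) * g)) × parity g ≡ stirlingParity k m)
  a₂-2-adic m δ′ δ′≤1 n≤j with halfPowerSum-2-adic δ′ δ′≤1 m k
  ... | g , eq , g-parity = g , trans (a₂≡-2^k*halfPowerSum n≤j) (cong (λ z → ℤ.- (ℤ.+ z)) (begin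
      2 ^ k * halfPowerSum k (m * 2 + δ′) ≡⟨ cong (2 ^ k *_) eq ⟩
      2 ^ k * (2 ^ v! m * g)              ≡⟨ *-assoc (2 ^ k) (2 ^ v! m) g ⟨
      2 ^ k * 2 ^ v! m * g                ≡⟨ cong (_* g) (^-distribˡ-+-* 2 k (v! m)) ⟨
      2 ^ (k + v! m) * g                  ∎)) , g-parity
    where open ≡-Reasoning

  M≤ : ∀ m δ′ → δ′ ≤ 1 → suc k ≤ m * 2 + δ′ → M ≤ m
  M≤ m δ′ δ′≤1 n≤j = m*2+δ-cancel-≤ {M} {m} {δ} {δ′} δ′≤1 (subst (_≤ m * 2 + δ′) n≡ n≤j)

  lower-bound : ∀ j → suc k ≤ j → [ s ] ≤∞ ν₂ (a₂ k j)
  lower-bound j n≤j with half-with-bit j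
  ... | m , δ′ , δ′≤1 , refl with a₂-2-adic m δ′ δ′≤1 n≤j
  ...   | g , eq , _ = subst (λ z → [ s ] ≤∞ ν₂ z) (sym eq)
            (2^∣⇒≤ν₂ (2 ^ (k + v! m) * g) (∣m⇒∣m*n g (2^-mono-∣ (+-monoʳ-≤ k (v!-mono (M≤ m δ′ δ′≤1 n≤j))))))

  -- A larger ν(m!) or an even cofactor g would each give a₂(k, j) one factor 2 too many.
  attained⇒stirling : ∀ j → suc k ≤ j → ν₂ (a₂ k j) ≡ [ s ] → StirlingCriterion k M
  attained⇒stirling j n≤j ν≡s with half-with-bit j
  ... | m , δ′ , δ′≤1 , refl with a₂-2-adic m δ′ δ′≤1 n≤j
  ...   | g , eq , g-parity with v!-constant (M≤ m δ′ δ′≤1 n≤j) v≤ | trans (sym g-parity) g-odd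
    where
    ¬d : 2 ^ suc s ∤ 2 ^ (k + v! m) * g
    ¬d = ν₂≡⇒∤ (2 ^ (k + v! m) * g) (trans (cong ν₂ (sym eq)) ν≡s)
    v≤ : v! m ≤ v! M
    v≤ = ≮⇒≥ λ v< → ¬d (∣m⇒∣m*n g (2^-mono-∣ (+-monoʳ-< k v<)))
    g-odd : parity g ≡ 1ℙ
    g-odd = 2∤⇒odd g λ 2∣g → ¬d (subst (_∣ 2 ^ (k + v! m) * g) (*-comm (2 ^ s) 2)
      (*-pres-∣ (2^-mono-∣ (+-monoʳ-≤ k (v!-mono (M≤ m δ′ δ′≤1 n≤j)))) 2∣g))
  ... | inj₁ refl            | odd = inj₁ odd
  ... | inj₂ (refl , M-even) | odd = inj₂ (M-even , odd)

  odd⇒attained : ∀ m δ′ → δ′ ≤ 1 → suc k ≤ m * 2 + δ′ → v! m ≡ v! M → stirlingParity k m ≡ 1ℙ →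
    ∃[ j ] (suc k ≤ j × ν₂ (a₂ k j) ≡ [ s ])
  odd⇒attained m δ′ δ′≤1 n≤j v≡ odd with a₂-2-adic m δ′ δ′≤1 n≤j
  ... | g , eq , g-parity = m * 2 + δ′ , n≤j , trans (cong ν₂ eq)
    (trans (ν₂-exact (2 ^ (k + v! m) * g) (m∣m*n g) ¬d) (cong (λ z → [ k + z ]) v≡))
    where
    ¬d : 2 ^ suc (k + v! m) ∤ 2 ^ (k + v! m) * g
    ¬d d = 1+n≰n (2^∣⇒≤ {suc (k + v! m)} {k + v! m} {g} (trans g-parity odd) d)

  stirling⇒attained : StirlingCriterion k M → ∃[ j ] (suc k ≤ j × ν₂ (a₂ k j) ≡ [ s ])
  stirling⇒attained (inj₁ odd) = odd⇒attained M δ δ≤1 (≤-reflexive n≡) refl odd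
  -- The witness is j = 2(M+1), which exceeds n ≤ 2M + 1; since M + 1 is odd, ν((M+1)!) = ν(M!).
  stirling⇒attained (inj₂ (M-even , odd)) = odd⇒attained (suc M) 0 z≤n n≤ (v!-suc-odd M 1+M-odd) odd
    where
    1+M-odd : parity (suc M) ≡ 1ℙ
    1+M-odd = ℙ.⁻¹-injective (trans (ℙ.suc-homo-⁻¹ M) M-even)
    n≤ : suc k ≤ suc M * 2 + 0
    n≤ = begin
      suc k          ≡⟨ n≡ ⟩
      M * 2 + δ      ≤⟨ +-monoʳ-≤ (M * 2) (m≤n⇒m≤1+n δ≤1) ⟩
      M * 2 + 2      ≡⟨ +-comm (M * 2) 2 ⟩
      suc M * 2      ≡⟨ +-identityʳ (suc M * 2) ⟨
      suc M * 2 + 0  ∎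
      where open ≤-Reasoning

  e₂⇔stirling : (e₂⟨ k , suc k ⟩≡ [ s₂ (suc k) ]) ⇔ StirlingCriterion k M
  e₂⇔stirling = subst (λ z → (e₂⟨ k , suc k ⟩≡ [ z ]) ⇔ StirlingCriterion k M) (sym (s₂≡ M δ δ≤1 n≡)) (mk⇔
    (λ { ((j , n≤j , ν≡s) , _) → attained⇒stirling j n≤j ν≡s })
    (λ crit → stirling⇒attained crit , λ { _ (j , n≤j , refl) → lower-bound j n≤j }))

-- Binomial coefficients and Stirling numbers modulo 2

C-pascal : ∀ n k → suc n C suc k ≡ n C k + n C suc k
C-pascal n k = sym (nCk+nC[k+1]≡[n+1]C[k+1] n k)

parity-C-pascal : ∀ n k → parity (suc n C suc k) ≡ parity (n C k) ℙ.+ parity (n C suc k)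
parity-C-pascal n k = trans (cong parity (C-pascal n k)) (ℙ.+-homo-+ (n C k) (n C suc k))

C-complement : ∀ a b → (a + b) C a ≡ (a + b) C b
C-complement a b = trans (nCk≡nC[n∸k] (m≤m+n a b)) (cong ((a + b) C_) (m+n∸m≡n a b))

-- The rule (k+1) C(n, k+1) = (n-k) C(n, k), rearranged to avoid subtraction.
C-absorb : ∀ n k → suc k * (n C suc k) + k * (n C k) ≡ n * (n C k)
C-absorb zero    zero    = refl
C-absorb zero    (suc k) = cong₂ _+_ (trans (cong (suc (suc k) *_) (k>n⇒nCk≡0 {0} {suc (suc k)} (s≤s z≤n))) (*-zeroʳ (suc (suc k))))
  (trans (cong (suc k *_) (k>n⇒nCk≡0 {0} {suc k} (s≤s z≤n))) (*-zeroʳ (suc k)))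
C-absorb (suc n) zero    = begin
  1 * (suc n C 1) + 0     ≡⟨ cong (λ z → 1 * z + 0) (C-pascal n 0) ⟩
  1 * (1 + n C 1) + 0     ≡⟨ lemma (n C 1) ⟩
  1 + (1 * (n C 1) + 0)   ≡⟨ cong (1 +_) (C-absorb n 0) ⟩
  1 + n * 1               ∎
  where
  open ≡-Reasoning
  lemma : ∀ x → 1 * (1 + x) + 0 ≡ 1 + (1 * x + 0)
  lemma = solve-∀
C-absorb (suc n) (suc k) = begin
  (2 + k) * (suc n C (2 + k)) + (1 + k) * (suc n C suc k)
    ≡⟨ cong₂ (λ x y → (2 + k) * x + (1 + k) * y) (C-pascal n (suc k)) (C-pascal n k) ⟩
  (2 + k) * (b + c) + (1 + k) * (a + b)
    ≡⟨ l₁ k a b c ⟩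
  ((2 + k) * c + (1 + k) * b) + ((1 + k) * b + k * a) + (a + b)
    ≡⟨ cong₂ (λ x y → x + y + (a + b)) (C-absorb n (suc k)) (C-absorb n k) ⟩
  n * b + n * a + (a + b)
    ≡⟨ l₂ n a b ⟩
  suc n * (a + b)
    ≡⟨ cong (suc n *_) (C-pascal n k) ⟨
  suc n * (suc n C suc k) ∎
  where
  open ≡-Reasoning
  a = n C k
  b = n C suc k
  c = n C suc (suc k)
  l₁ : ∀ k a b c → (2 + k) * (b + c) + (1 + k) * (a + b) ≡ ((2 + k) * c + (1 + k) * b) + ((1 + k) * b + k * a) + (a + b)
  l₁ = solve-∀
  l₂ : ∀ n a b → n * b + n * a + (a + b) ≡ (1 + n) * (a + b)
  l₂ = solve-∀

-- Here the upper index minus the lower one is n + 1, half of 2n + 2, so `C-absorb` makes this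
-- coefficient twice the next one in its row.
parity-C-[2+3n] : ∀ n → parity ((2 + 3 * n) C (1 + 2 * n)) ≡ 0ℙ
parity-C-[2+3n] n = trans (cong parity x≡2y) (ℙ.*-homo-* 2 y)
  where
  x = (2 + 3 * n) C (1 + 2 * n)
  y = (2 + 3 * n) C (2 + 2 * n)
  l₁ : ∀ n x y → (1 + n) * x + (1 + 2 * n) * x ≡ (2 + 3 * n) * x
  l₁ = solve-∀
  l₂ : ∀ n y → (2 + 2 * n) * y ≡ (1 + n) * (2 * y)
  l₂ = solve-∀
  x≡2y : x ≡ 2 * y
  x≡2y = *-cancelˡ-≡ x (2 * y) (suc n) (+-cancelʳ-≡ ((1 + 2 * n) * x) _ _
    (trans (l₁ n x y) (trans (sym (C-absorb (2 + 3 * n) (1 + 2 * n))) (cong (_+ (1 + 2 * n) * x) (l₂ n y)))))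

-- Lucas' theorem for the prime 2, one binary digit at a time.
C-double-odd : ∀ n k → parity ((2 * n) C (1 + 2 * k)) ≡ 0ℙ
C-double : ∀ n k → parity ((2 * n) C (2 * k)) ≡ parity (n C k)
C-1+double-odd : ∀ n k → parity ((1 + 2 * n) C (1 + 2 * k)) ≡ parity (n C k)
C-1+double : ∀ n k → parity ((1 + 2 * n) C (2 * k)) ≡ parity (n C k)

C-1+double-odd n k = trans (parity-C-pascal (2 * n) (2 * k))
  (trans (cong₂ ℙ._+_ (C-double n k) (C-double-odd n k)) (ℙ.+-identityʳ _))

C-1+double n zero    = refl
C-1+double n (suc k) = begin
  parity ((1 + 2 * n) C (2 * suc k))  ≡⟨ cong (λ z → parity ((1 + 2 * n) C z)) (*-suc 2 k) ⟩
  parity ((1 + 2 * n) C (2 + 2 * k))  ≡⟨ parity-C-pascal (2 * n) (1 + 2 * k) ⟩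
  parity ((2 * n) C (1 + 2 * k)) ℙ.+ parity ((2 * n) C (2 + 2 * k)) ≡⟨ cong₂ (λ x y → x ℙ.+ parity ((2 * n) C y)) (C-double-odd n k) (sym (*-suc 2 k)) ⟩
  parity ((2 * n) C (2 * suc k))      ≡⟨ C-double n (suc k) ⟩
  parity (n C suc k)                  ∎
  where open ≡-Reasoning

C-double zero    zero    = refl
C-double zero    (suc k) = refl
C-double (suc n) zero    = refl
C-double (suc n) (suc k) = begin
  parity ((2 * suc n) C (2 * suc k))  ≡⟨ cong₂ (λ x y → parity (x C y)) (*-suc 2 n) (*-suc 2 k) ⟩
  parity ((2 + 2 * n) C (2 + 2 * k))  ≡⟨ parity-C-pascal (1 + 2 * n) (1 + 2 * k) ⟩
  parity ((1 + 2 * n) C (1 + 2 * k)) ℙ.+ parity ((1 + 2 * n) C (2 + 2 * k))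
    ≡⟨ cong₂ (λ x y → x ℙ.+ parity ((1 + 2 * n) C y)) (C-1+double-odd n k) (sym (*-suc 2 k)) ⟩
  parity (n C k) ℙ.+ parity ((1 + 2 * n) C (2 * suc k)) ≡⟨ cong (parity (n C k) ℙ.+_) (C-1+double n (suc k)) ⟩
  parity (n C k) ℙ.+ parity (n C suc k) ≡⟨ parity-C-pascal n k ⟨
  parity (suc n C suc k)              ∎
  where open ≡-Reasoning

C-double-odd zero    k = refl
C-double-odd (suc n) k = begin
  parity ((2 * suc n) C (1 + 2 * k))  ≡⟨ cong (λ x → parity (x C (1 + 2 * k))) (*-suc 2 n) ⟩
  parity ((2 + 2 * n) C (1 + 2 * k))  ≡⟨ parity-C-pascal (1 + 2 * n) (2 * k) ⟩
  parity ((1 + 2 * n) C (2 * k)) ℙ.+ parity ((1 + 2 * n) C (1 + 2 * k)) ≡⟨ cong₂ ℙ._+_ (C-1+double n k) (C-1+double-odd n k) ⟩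
  parity (n C k) ℙ.+ parity (n C k)   ≡⟨ ℙ.p+p≡0ℙ (parity (n C k)) ⟩
  0ℙ                                  ∎
  where open ≡-Reasoning

-- Closed form for the parity of Stirling numbers

stirling-below : ∀ {k m} → k < m → stirlingParity k m ≡ 0ℙ
stirling-below {zero}  {suc m} _ = refl
stirling-below {suc k} {suc m} (s≤s k<m) = trans
  (cong₂ (λ x y → parity (suc m) ℙ.* x ℙ.+ y) (stirling-below (m<n⇒m<1+n k<m)) (stirling-below k<m))
  (trans (cong (ℙ._+ 0ℙ) (ℙ.*-zeroʳ (parity (suc m)))) refl)

parity-2+2*n : ∀ t → parity (2 + 2 * t) ≡ 0ℙ
parity-2+2*n t = ℙ.*-homo-* 2 t

-- Modulo 2 the generating function x^m / ((1-x)(1-2x)...(1-mx)) is x^m / (1-x)^(t+1) for both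
-- values of m. In the recurrence, an even m drops the first summand and an odd m gives Pascal's
-- rule.
stirling-odd  : ∀ t a → stirlingParity (1 + 2 * t + a) (1 + 2 * t) ≡ parity ((t + a) C a)
stirling-even : ∀ t a → stirlingParity (2 + 2 * t + a) (2 + 2 * t) ≡ parity ((t + a) C a)

stirling-even t a = begin
  parity (2 + 2 * t) ℙ.* stirlingParity (1 + 2 * t + a) (2 + 2 * t) ℙ.+ stirlingParity (1 + 2 * t + a) (1 + 2 * t)
    ≡⟨ cong₂ (λ x y → x ℙ.* stirlingParity (1 + 2 * t + a) (2 + 2 * t) ℙ.+ y) (parity-2+2*n t) (stirling-odd t a) ⟩
  parity ((t + a) C a) ∎
  where open ≡-Reasoning

stirling-odd t zero = begin
  parity (1 + 2 * t) ℙ.* stirlingParity (2 * t + 0) (1 + 2 * t) ℙ.+ stirlingParity (2 * t + 0) (2 * t)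
    ≡⟨ cong (λ x → parity (1 + 2 * t) ℙ.* x ℙ.+ stirlingParity (2 * t + 0) (2 * t))
         (stirling-below (s≤s (≤-reflexive (+-identityʳ (2 * t))))) ⟩
  parity (1 + 2 * t) ℙ.* 0ℙ ℙ.+ stirlingParity (2 * t + 0) (2 * t)
    ≡⟨ cong (ℙ._+ stirlingParity (2 * t + 0) (2 * t)) (ℙ.*-zeroʳ (parity (1 + 2 * t))) ⟩
  stirlingParity (2 * t + 0) (2 * t)
    ≡⟨ diagonal t ⟩
  1ℙ ∎
  where
  open ≡-Reasoning
  diagonal : ∀ t → stirlingParity (2 * t + 0) (2 * t) ≡ 1ℙ
  diagonal zero    = refl
  diagonal (suc t) = subst (λ z → stirlingParity (z + 0) z ≡ 1ℙ) (sym (*-suc 2 t)) (stirling-even t 0)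
stirling-odd zero (suc a) = begin
  stirlingParity (1 + a) 1 ℙ.+ 0ℙ     ≡⟨ ℙ.+-identityʳ _ ⟩
  stirlingParity (1 + a) 1            ≡⟨ stirling-odd zero a ⟩
  parity (a C a)                      ≡⟨ cong parity (trans (nCn≡1 a) (sym (nCn≡1 (suc a)))) ⟩
  parity (suc a C suc a)              ∎
  where open ≡-Reasoning
stirling-odd (suc t) (suc a) = begin
  parity (1 + 2 * suc t) ℙ.* stirlingParity (2 * suc t + suc a) (1 + 2 * suc t) ℙ.+ stirlingParity (2 * suc t + suc a) (2 * suc t)
    ≡⟨ cong₂ (λ x y → x ℙ.* y ℙ.+ stirlingParity (2 * suc t + suc a) (2 * suc t)) (parity-1+2*n (suc t))
         (trans (cong (λ z → stirlingParity z (1 + 2 * suc t)) (+-suc (2 * suc t) a)) (stirling-odd (suc t) a)) ⟩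
  parity ((suc t + a) C a) ℙ.+ stirlingParity (2 * suc t + suc a) (2 * suc t)
    ≡⟨ cong (parity ((suc t + a) C a) ℙ.+_)
         (trans (cong (λ z → stirlingParity (z + suc a) z) (*-suc 2 t)) (stirling-even t (suc a))) ⟩
  parity ((suc t + a) C a) ℙ.+ parity ((t + suc a) C suc a)
    ≡⟨ cong (λ z → parity ((suc t + a) C a) ℙ.+ parity (z C suc a)) (+-suc t a) ⟩
  parity ((suc t + a) C a) ℙ.+ parity ((suc t + a) C suc a)
    ≡⟨ parity-C-pascal (suc t + a) a ⟨
  parity (suc (suc t + a) C suc a)
    ≡⟨ cong (λ z → parity (z C suc a)) (sym (+-suc (suc t) a)) ⟩
  parity ((suc t + suc a) C suc a) ∎
  where open ≡-Reasoning

-- The indices are variables tied by equations, so that each use only has to supply identities of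
-- polynomials.
stirling-odd′ : ∀ {k m N} t a → k ≡ 1 + 2 * t + a → m ≡ 1 + 2 * t → t + a ≡ N → stirlingParity k m ≡ parity (N C a)
stirling-odd′ t a refl refl refl = stirling-odd t a

stirling-even′ : ∀ {k m N} t a → k ≡ 2 + 2 * t + a → m ≡ 2 + 2 * t → t + a ≡ N → stirlingParity k m ≡ parity (N C a)
stirling-even′ t a refl refl refl = stirling-even t a

C-complement′ : ∀ {n} a b → n ≡ a + b → parity (n C a) ≡ parity (n C b)
C-complement′ a b refl = cong parity (C-complement a b)

-- n = 2^ε (2s+1) by cases

SharpBound : ℕ → Set
SharpBound n = e₂⟨ n ∸ 1 , n ⟩≡ [ s₂ n ]

-- The hypothesis on `suc M` says that the second alternative of the criterion never holds without
-- the first, so the parity of S(k, M) alone decides.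
sharp⇔∤ : ∀ {n} k M δ x → δ ≤ 1 → n ≡ suc k → suc k ≡ M * 2 + δ →
  stirlingParity k M ≡ parity x →
  (parity M ≡ 0ℙ → stirlingParity k (suc M) ≡ 1ℙ → stirlingParity k M ≡ 1ℙ) →
  SharpBound n ⇔ 2 ∤ x
sharp⇔∤ k M δ x δ≤1 refl n≡ S≡x next = ⇔.trans (e₂⇔stirling δ≤1 n≡) (mk⇔
  (odd⇒2∤ ∘ trans (sym S≡x) ∘ [ id , (λ { (M-even , odd) → next M-even odd }) ]′)
  (inj₁ ∘ trans S≡x ∘ 2∤⇒odd x))

odd≢even : ∀ {p} {A : Set} → p ≡ 1ℙ → p ≡ 0ℙ → A
odd≢even refl ()

-- Here k = 2s and M = s, so the parity of s selects the closed form. For odd s = 2t + 1 the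
-- Stirling parity is that of C(3t+1, t), and appending the binary digit 1 to both entries gives
-- C(3s, s).
sharp-[2s+1] : ∀ {n} s → n ≡ suc (2 * s) → SharpBound n ⇔ 2 ∤ (3 * s) C s
sharp-[2s+1] s n≡ with half s
... | 1+2* t = sharp⇔∤ (2 * s′) s′ 1 ((3 * s′) C s′) ≤-refl n≡ (l₀ s′) S≡ (odd≢even (parity-1+2*n t))
  where
  open ≡-Reasoning
  s′ = 1 + 2 * t
  l₀ : ∀ s → suc (2 * s) ≡ s * 2 + 1
  l₀ = solve-∀
  l₁ : ∀ t → 2 * (1 + 2 * t) ≡ 1 + 2 * t + (1 + 2 * t)
  l₁ = solve-∀
  l₂ : ∀ t → t + (1 + 2 * t) ≡ 1 + 3 * t
  l₂ = solve-∀
  l₃ : ∀ t → 1 + 3 * t ≡ 1 + 2 * t + t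
  l₃ = solve-∀
  l₄ : ∀ t → 1 + 2 * (1 + 3 * t) ≡ 3 * (1 + 2 * t)
  l₄ = solve-∀
  S≡ : stirlingParity (2 * s′) s′ ≡ parity ((3 * s′) C s′)
  S≡ = begin
    stirlingParity (2 * s′) s′            ≡⟨ stirling-odd′ t (1 + 2 * t) (l₁ t) refl (l₂ t) ⟩
    parity ((1 + 3 * t) C (1 + 2 * t))    ≡⟨ C-complement′ (1 + 2 * t) t (l₃ t) ⟩
    parity ((1 + 3 * t) C t)              ≡⟨ C-1+double-odd (1 + 3 * t) t ⟨
    parity ((1 + 2 * (1 + 3 * t)) C s′)   ≡⟨ cong (λ z → parity (z C s′)) (l₄ t) ⟩
    parity ((3 * s′) C s′)                ∎
... | 2* zero = sharp⇔∤ 0 0 1 1 ≤-refl n≡ refl refl (λ _ _ → refl)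
-- Now M is even, but S(k, M+1) has the parity of C(3t+2, 2t+1), which is even.
... | 2* suc t = sharp⇔∤ (2 * s′) s′ 1 ((3 * s′) C s′) ≤-refl n≡ (l₀ s′) S≡
      (λ _ odd → odd≢even odd S′≡)
  where
  open ≡-Reasoning
  s′ = 2 * suc t
  l₀ : ∀ s → suc (2 * s) ≡ s * 2 + 1
  l₀ = solve-∀
  l₁ : ∀ t → 2 * (2 * (1 + t)) ≡ 2 + 2 * t + (2 + 2 * t)
  l₁ = solve-∀
  l₂ : ∀ t → t + (2 + 2 * t) ≡ 2 + 3 * t
  l₂ = solve-∀
  l₃ : ∀ t → 3 + 3 * t ≡ 2 + 2 * t + (1 + t)
  l₃ = solve-∀
  l₄ : ∀ t → 2 * (3 + 3 * t) ≡ 3 * (2 * (1 + t))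
  l₄ = solve-∀
  l₅ : ∀ t → 2 * (2 * (1 + t)) ≡ 1 + 2 * (1 + t) + (1 + 2 * t)
  l₅ = solve-∀
  l₆ : ∀ t → 1 + t + (1 + 2 * t) ≡ 2 + 3 * t
  l₆ = solve-∀
  S≡ : stirlingParity (2 * s′) s′ ≡ parity ((3 * s′) C s′)
  S≡ = begin
    stirlingParity (2 * s′) s′                 ≡⟨ stirling-even′ t (2 + 2 * t) (l₁ t) (*-suc 2 t) (l₂ t) ⟩
    parity ((2 + 3 * t) C (2 + 2 * t))
      -- Adding the even coefficient C(3t+2, 2t+1) allows Pascal's rule to reach C(3(t+1), 2(t+1)).
      ≡⟨ cong (ℙ._+ parity ((2 + 3 * t) C (2 + 2 * t))) (parity-C-[2+3n] t) ⟨
    parity ((2 + 3 * t) C (1 + 2 * t)) ℙ.+ parity ((2 + 3 * t) C (2 + 2 * t))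
      ≡⟨ parity-C-pascal (2 + 3 * t) (1 + 2 * t) ⟨
    parity ((3 + 3 * t) C (2 + 2 * t))         ≡⟨ C-complement′ (2 + 2 * t) (1 + t) (l₃ t) ⟩
    parity ((3 + 3 * t) C (1 + t))             ≡⟨ C-double (3 + 3 * t) (1 + t) ⟨
    parity ((2 * (3 + 3 * t)) C s′)            ≡⟨ cong (λ z → parity (z C s′)) (l₄ t) ⟩
    parity ((3 * s′) C s′)                     ∎
  S′≡ : stirlingParity (2 * s′) (suc s′) ≡ 0ℙ
  S′≡ = trans (stirling-odd′ (1 + t) (1 + 2 * t) (l₅ t) refl (l₆ t)) (parity-C-[2+3n] t)

C-3n : ∀ s → parity ((3 * s) C (2 * s)) ≡ parity ((3 * s) C s)
C-3n s = C-complement′ (2 * s) s (lemma s)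
  where
  lemma : ∀ s → 3 * s ≡ 2 * s + s
  lemma = solve-∀

sharp-2[2s+1] : ∀ {n} s → n ≡ suc (1 + 4 * s) → SharpBound n ⇔ 2 ∤ (3 * s) C s
sharp-2[2s+1] s n≡ = sharp⇔∤ (1 + 4 * s) (1 + 2 * s) 0 ((3 * s) C s) z≤n n≡ (l₀ s)
  (trans (stirling-odd′ s (2 * s) (l₁ s) refl refl) (C-3n s)) (odd≢even (parity-1+2*n s))
  where
  l₀ : ∀ s → suc (1 + 4 * s) ≡ (1 + 2 * s) * 2 + 0
  l₀ = solve-∀
  l₁ : ∀ s → 1 + 4 * s ≡ 1 + 2 * s + 2 * s
  l₁ = solve-∀

-- With M = 4s + 2 both alternatives amount to the same: C(6s+1, 4s+1) and C(6s+1, 4s) both reduce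
-- to C(3s, 2s) when the last binary digit is removed.
sharp-4[2s+1] : ∀ {n} s → n ≡ suc (3 + 8 * s) → SharpBound n ⇔ 2 ∤ (3 * s) C s
sharp-4[2s+1] s n≡ = sharp⇔∤ (3 + 8 * s) (2 + 4 * s) 0 ((3 * s) C s) z≤n n≡ (l₀ s)
  (trans S≡ (C-3n s)) (λ _ odd → trans S≡ (trans (sym S′≡) odd))
  where
  l₀ : ∀ s → suc (3 + 8 * s) ≡ (2 + 4 * s) * 2 + 0
  l₀ = solve-∀
  l₁ : ∀ s → 3 + 8 * s ≡ 2 + 2 * (2 * s) + (1 + 2 * (2 * s))
  l₁ = solve-∀
  l₂ : ∀ s → 2 + 4 * s ≡ 2 + 2 * (2 * s)
  l₂ = solve-∀
  l₃ : ∀ s → 2 * s + (1 + 2 * (2 * s)) ≡ 1 + 2 * (3 * s)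
  l₃ = solve-∀
  l₄ : ∀ s → 3 + 8 * s ≡ 1 + 2 * (1 + 2 * s) + 2 * (2 * s)
  l₄ = solve-∀
  l₅ : ∀ s → 3 + 4 * s ≡ 1 + 2 * (1 + 2 * s)
  l₅ = solve-∀
  l₆ : ∀ s → 1 + 2 * s + 2 * (2 * s) ≡ 1 + 2 * (3 * s)
  l₆ = solve-∀
  S≡ : stirlingParity (3 + 8 * s) (2 + 4 * s) ≡ parity ((3 * s) C (2 * s))
  S≡ = trans (stirling-even′ (2 * s) (1 + 2 * (2 * s)) (l₁ s) (l₂ s) (l₃ s)) (C-1+double-odd (3 * s) (2 * s))
  S′≡ : stirlingParity (3 + 8 * s) (3 + 4 * s) ≡ parity ((3 * s) C (2 * s))
  S′≡ = trans (stirling-odd′ (1 + 2 * s) (2 * (2 * s)) (l₄ s) (l₅ s) (l₆ s)) (C-1+double (3 * s) (2 * s))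

-- With M = 4u + 4 both alternatives fail: C(6u+4, 4u+3) has an even upper and an odd lower index,
-- and C(6u+4, 4u+2) reduces to the even C(3u+2, 2u+1).
¬sharp-8[1+u] : ∀ {n} u → n ≡ suc (7 + 8 * u) → ¬ SharpBound n
¬sharp-8[1+u] u n≡ = λ sharp → Equivalence.to equivalence sharp (2 ∣0)
  where
  l₀ : ∀ u → suc (7 + 8 * u) ≡ (4 + 4 * u) * 2 + 0
  l₀ = solve-∀
  l₁ : ∀ u → 7 + 8 * u ≡ 2 + 2 * (1 + 2 * u) + (1 + 2 * (1 + 2 * u))
  l₁ = solve-∀
  l₂ : ∀ u → 4 + 4 * u ≡ 2 + 2 * (1 + 2 * u)
  l₂ = solve-∀
  l₃ : ∀ u → 1 + 2 * u + (1 + 2 * (1 + 2 * u)) ≡ 2 * (2 + 3 * u)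
  l₃ = solve-∀
  l₄ : ∀ u → 7 + 8 * u ≡ 1 + 2 * (2 + 2 * u) + 2 * (1 + 2 * u)
  l₄ = solve-∀
  l₅ : ∀ u → 5 + 4 * u ≡ 1 + 2 * (2 + 2 * u)
  l₅ = solve-∀
  l₆ : ∀ u → 2 + 2 * u + 2 * (1 + 2 * u) ≡ 2 * (2 + 3 * u)
  l₆ = solve-∀
  S≡ : stirlingParity (7 + 8 * u) (4 + 4 * u) ≡ 0ℙ
  S≡ = trans (stirling-even′ (1 + 2 * u) (1 + 2 * (1 + 2 * u)) (l₁ u) (l₂ u) (l₃ u)) (C-double-odd (2 + 3 * u) (1 + 2 * u))
  S′≡ : stirlingParity (7 + 8 * u) (5 + 4 * u) ≡ 0ℙ
  S′≡ = trans (stirling-odd′ (2 + 2 * u) (2 * (1 + 2 * u)) (l₄ u) (l₅ u) (l₆ u))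
    (trans (C-double (2 + 3 * u) (1 + 2 * u)) (parity-C-[2+3n] u))
  -- The choice x = 0 makes the right-hand side `2 ∤ 0`, which is absurd.
  equivalence = sharp⇔∤ (7 + 8 * u) (4 + 4 * u) 0 0 z≤n n≡ (l₀ u) S≡ (λ _ odd → odd≢even odd S′≡)

sharp⇔odd : ∀ {n} ε s → ε ≤ 2 → n ≡ 2 ^ ε * (2 * s + 1) → SharpBound n ⇔ 2 ∤ (3 * s) C s
sharp⇔odd 0 s _ n≡ = sharp-[2s+1] s (trans n≡ (lemma s))
  where
  lemma : ∀ s → 1 * (2 * s + 1) ≡ suc (2 * s)
  lemma = solve-∀
sharp⇔odd 1 s _ n≡ = sharp-2[2s+1] s (trans n≡ (lemma s))
  where
  lemma : ∀ s → 2 * (2 * s + 1) ≡ suc (1 + 4 * s)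
  lemma = solve-∀
sharp⇔odd 2 s _ n≡ = sharp-4[2s+1] s (trans n≡ (lemma s))
  where
  lemma : ∀ s → 4 * (2 * s + 1) ≡ suc (3 + 8 * s)
  lemma = solve-∀
sharp⇔odd (suc (suc (suc _))) _ (s≤s (s≤s ()))

2-adic-valuation≤2 : ∀ n → 1 ≤ n → (∃₂ λ ε s → ε ≤ 2 × n ≡ 2 ^ ε * (2 * s + 1)) ⊎ (∃[ u ] n ≡ suc (7 + 8 * u))
2-adic-valuation≤2 n 1≤n with half n
... | 1+2* s = inj₁ (0 , s , z≤n , lemma s)
  where
  lemma : ∀ s → 1 + 2 * s ≡ 1 * (2 * s + 1)
  lemma = solve-∀
... | 2* m with half m
...   | 1+2* s = inj₁ (1 , s , s≤s z≤n , lemma s)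
  where
  lemma : ∀ s → 2 * (1 + 2 * s) ≡ 2 * (2 * s + 1)
  lemma = solve-∀
...   | 2* m′ with half m′
...     | 1+2* s = inj₁ (2 , s , ≤-refl , lemma s)
  where
  lemma : ∀ s → 2 * (2 * (1 + 2 * s)) ≡ 4 * (2 * s + 1)
  lemma = solve-∀
...     | 2* zero = contradiction 1≤n λ ()
...     | 2* suc u = inj₂ (u , lemma u)
  where
  lemma : ∀ u → 2 * (2 * (2 * (1 + u))) ≡ suc (7 + 8 * u)
  lemma = solve-∀

theorem1p7 : (n : ℕ) → 1 ≤ n →
    (e₂⟨ n ∸ 1 , n ⟩≡ [ s₂ n ])
    ⇔ (∃₂ λ ε s → ε ≤ 2 × n ≡ 2 ^ ε * (2 * s + 1) × ¬ (2 ∣ (3 * s) C s))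
theorem1p7 n 1≤n = mk⇔ to from
  where
  to : SharpBound n → ∃₂ λ ε s → ε ≤ 2 × n ≡ 2 ^ ε * (2 * s + 1) × ¬ (2 ∣ (3 * s) C s)
  to sharp with 2-adic-valuation≤2 n 1≤n
  ... | inj₁ (ε , s , ε≤2 , n≡) = ε , s , ε≤2 , n≡ , Equivalence.to (sharp⇔odd ε s ε≤2 n≡) sharp
  ... | inj₂ (u , n≡)           = contradiction sharp (¬sharp-8[1+u] u n≡)
  from : (∃₂ λ ε s → ε ≤ 2 × n ≡ 2 ^ ε * (2 * s + 1) × ¬ (2 ∣ (3 * s) C s)) → SharpBound n
  from (ε , s , ε≤2 , n≡ , odd) = Equivalence.from (sharp⇔odd ε s ε≤2 n≡) odd
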